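{- The continued fraction \[ 2+\cfrac{ -16\cdot 1^6}{36+\cfrac{ -16\cdot 2^6}{160+\cfrac{ -16\cdot 3^6}{434+\ddots}}} \] with partial denominators $a_n=(2n+1)(5n^2+5n+2)$ ($n\ge 0$) and partial numerators $b_n=-16n^6$ ($n\ge 1$) converges, and its value is \[ \frac{12}{7\zeta(3)}. \] Equivalently, $\operatorname{PCF}\bigl((2n+1)(5n^2+5n+2),-16n^6\bigr)=\dfrac{12}{7\zeta(3)}$.
   Context: $\zeta$ denotes the Riemann zeta function. For sequences $a_n,b_n$, $\operatorname{PCF}(a_n,b_n)$ denotes the continued fraction $a_0+\cfrac{b_1}{a_1+\cfrac{b_2}{a_2+\ddots}}$. Its convergents are $P_n/Q_n$, where $P_{ -1}=1$, $P_0=a_0$, $Q_{ -1}=0$, $Q_0=1$, and $U_n=a_nU_{n-1}+b_nU_{n-2}$ for $n\ge 1$ with $U=P$ or $U=Q$. The continued fraction converges to a value $v$ if $P_n/Q_n\to v$ as $n\to\infty$. -}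

module Defs where

open import Data.Nat as ℕ using (ℕ; zero; suc)
import Data.Nat.Properties as ℕₚ
open import Data.Integer as ℤ using (+_)
import Data.Integer.Properties as ℤₚ
open import Data.Product using (Σ; ∃; _×_; _,_)
open import Data.Rational as ℚ using (ℚ; 0ℚ; 1ℚ; mkℚ)
import Data.Rational.Properties as ℚₚ
import Data.Rational.Unnormalised as ℚᵘ
import Data.Rational.Unnormalised.Properties as ℚᵘₚ
open import Data.Nat.Solver using () renaming (module +-*-Solver to ℕ+)
open import Data.Rational.Solver using (module +-*-Solver)
open import Data.Sum using (inj₁; inj₂)
open import Relation.Binary.PropositionalEquality
  using (_≡_; _≢_; refl; sym; trans; cong; cong₂; subst; module ≡-Reasoning)
open import Relation.Nullary using (yes; no; contradiction)

module RationalLemmas where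
  open import Data.Rational
  open +-*-Solver

  ∣p-q∣≡∣q-p∣ : ∀ p q → ∣ p - q ∣ ≡ ∣ q - p ∣
  ∣p-q∣≡∣q-p∣ p q =
    trans (cong ∣_∣ (solve 2 (λ x y → x :- y := :- (y :- x)) refl p q)) (ℚₚ.∣-p∣≡∣p∣ (q - p))

  *-mono-≤ : ∀ {p q r s} → 0ℚ ≤ r → 0ℚ ≤ q → p ≤ q → r ≤ s → p * r ≤ q * s
  *-mono-≤ {p} {q} {r} 0≤r 0≤q p≤q r≤s =
    ℚₚ.≤-trans (ℚₚ.*-monoʳ-≤-nonNeg r {{nonNegative 0≤r}} p≤q)
               (ℚₚ.*-monoˡ-≤-nonNeg q {{nonNegative 0≤q}} r≤s)

  *-pos : ∀ {p q} → 0ℚ < p → 0ℚ < q → 0ℚ < p * q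
  *-pos {p} {q} 0<p 0<q =
    ℚₚ.positive⁻¹ (p * q) {{ℚₚ.pos*pos⇒pos p {{positive 0<p}} q {{positive 0<q}}}}

  +-pos : ∀ {p q} → 0ℚ < p → 0ℚ < q → 0ℚ < p + q
  +-pos = ℚₚ.+-mono-<

  p≤∣p∣ : ∀ p → p ≤ ∣ p ∣
  p≤∣p∣ p with ℚₚ.≤-total 0ℚ p
  ... | inj₁ 0≤p = ℚₚ.≤-reflexive (sym (ℚₚ.0≤p⇒∣p∣≡p 0≤p))
  ... | inj₂ p≤0 = ℚₚ.≤-trans p≤0 (ℚₚ.0≤∣p∣ p)

  ∣p∣-∣q∣≤∣p-q∣ : ∀ p q → ∣ p ∣ - ∣ q ∣ ≤ ∣ p - q ∣
  ∣p∣-∣q∣≤∣p-q∣ p q = begin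
    ∣ p ∣ - ∣ q ∣                ≡⟨ cong (λ z → ∣ z ∣ - ∣ q ∣)
                                         (solve 2 (λ x y → x := (x :- y) :+ y) refl p q) ⟩
    ∣ (p - q) + q ∣ - ∣ q ∣      ≤⟨ ℚₚ.+-monoˡ-≤ (- ∣ q ∣) (ℚₚ.∣p+q∣≤∣p∣+∣q∣ (p - q) q) ⟩
    (∣ p - q ∣ + ∣ q ∣) - ∣ q ∣  ≡⟨ solve 2 (λ x y → (x :+ y) :- y := x) refl ∣ p - q ∣ ∣ q ∣ ⟩
    ∣ p - q ∣                    ∎
    where open ℚₚ.≤-Reasoning

  ∣∣p∣-∣q∣∣≤∣p-q∣ : ∀ p q → ∣ ∣ p ∣ - ∣ q ∣ ∣ ≤ ∣ p - q ∣
  ∣∣p∣-∣q∣∣≤∣p-q∣ p q with ℚₚ.∣p∣≡p∨∣p∣≡-p (∣ p ∣ - ∣ q ∣)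
  ... | inj₁ eq = ℚₚ.≤-trans (ℚₚ.≤-reflexive eq) (∣p∣-∣q∣≤∣p-q∣ p q)
  ... | inj₂ eq = begin
    ∣ ∣ p ∣ - ∣ q ∣ ∣  ≡⟨ eq ⟩
    - (∣ p ∣ - ∣ q ∣)  ≡⟨ solve 2 (λ x y → :- (x :- y) := y :- x) refl ∣ p ∣ ∣ q ∣ ⟩
    ∣ q ∣ - ∣ p ∣      ≤⟨ ∣p∣-∣q∣≤∣p-q∣ q p ⟩
    ∣ q - p ∣          ≡⟨ ∣p-q∣≡∣q-p∣ q p ⟩
    ∣ p - q ∣          ∎
    where open ℚₚ.≤-Reasoning

  ∣p∣≤∣q∣+∣p-q∣ : ∀ p q → ∣ p ∣ ≤ ∣ q ∣ + ∣ p - q ∣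
  ∣p∣≤∣q∣+∣p-q∣ p q = begin
    ∣ p ∣                    ≡⟨ solve 2 (λ x y → x := y :+ (x :- y)) refl ∣ p ∣ ∣ q ∣ ⟩
    ∣ q ∣ + (∣ p ∣ - ∣ q ∣)  ≤⟨ ℚₚ.+-monoʳ-≤ ∣ q ∣ (∣p∣-∣q∣≤∣p-q∣ p q) ⟩
    ∣ q ∣ + ∣ p - q ∣        ∎
    where open ℚₚ.≤-Reasoning

  /-≤-/ : ∀ i j m n → i ℤ.* + suc n ℤ.≤ j ℤ.* + suc m → i / suc m ≤ j / suc n
  /-≤-/ i j m n le = ℚₚ.toℚᵘ-cancel-≤ (begin
    toℚᵘ (i / suc m)  ≃⟨ ℚₚ.toℚᵘ-fromℚᵘ (ℚᵘ.mkℚᵘ i m) ⟩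
    ℚᵘ.mkℚᵘ i m       ≤⟨ ℚᵘ.*≤* le ⟩
    ℚᵘ.mkℚᵘ j n       ≃⟨ ℚₚ.toℚᵘ-fromℚᵘ (ℚᵘ.mkℚᵘ j n) ⟨
    toℚᵘ (j / suc n)  ∎)
    where open ℚᵘₚ.≤-Reasoning

  1/-anti-≤ : ∀ m n .{{_ : ℕ.NonZero m}} .{{_ : ℕ.NonZero n}} → n ℕ.≤ m → + 1 / m ≤ + 1 / n
  1/-anti-≤ (suc m) (suc n) n≤m = /-≤-/ (+ 1) (+ 1) m n (ℤₚ.*-monoˡ-≤-nonNeg (+ 1) (ℤ.+≤+ n≤m))

  0≤1/n : ∀ n .{{_ : ℕ.NonZero n}} → 0ℚ ≤ + 1 / n
  0≤1/n n = ℚₚ.nonNegative⁻¹ (+ 1 / n) {{ℚₚ.normalize-nonNeg 1 n}}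

  1/[1+n]+1/n[1+n]≡1/n : ∀ n .{{_ : ℕ.NonZero n}} .{{_ : ℕ.NonZero (suc n ℕ.* n)}} →
                         (+ 1 / suc n) + (+ 1 / (suc n ℕ.* n)) ≡ + 1 / n
  1/[1+n]+1/n[1+n]≡1/n n@(suc k) = ℚₚ.toℚᵘ-injective (begin-equality
    toℚᵘ ((+ 1 / suc n) + (+ 1 / (suc n ℕ.* n)))
      ≃⟨ ℚₚ.toℚᵘ-homo-+ (+ 1 / suc n) (+ 1 / (suc n ℕ.* n)) ⟩
    toℚᵘ (+ 1 / suc n) ℚᵘ.+ toℚᵘ (+ 1 / (suc n ℕ.* n))
      ≃⟨ ℚᵘₚ.+-cong (ℚₚ.toℚᵘ-fromℚᵘ (+ 1 ℚᵘ./ suc n)) (ℚₚ.toℚᵘ-fromℚᵘ (+ 1 ℚᵘ./ (suc n ℕ.* n))) ⟩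
    (+ 1 ℚᵘ./ suc n) ℚᵘ.+ (+ 1 ℚᵘ./ (suc n ℕ.* n))
      ≃⟨ ℚᵘ.*≡* (cong +_ (ℕ+.solve 1 (λ x → let sx = ℕ+.con 1 ℕ+.:+ x in
           (ℕ+.con 1 ℕ+.:* (sx ℕ+.:* x) ℕ+.:+ ℕ+.con 1 ℕ+.:* sx) ℕ+.:* x
             ℕ+.:= ℕ+.con 1 ℕ+.:* (sx ℕ+.:* (sx ℕ+.:* x))) refl n)) ⟩
    + 1 ℚᵘ./ n
      ≃⟨ ℚₚ.toℚᵘ-fromℚᵘ (+ 1 ℚᵘ./ n) ⟨
    toℚᵘ (+ 1 / n)
      ∎)
    where
    open ℚᵘₚ.≤-Reasoning

  1/n≤ : ∀ ε → 0ℚ < ε → ∃ λ n → + 1 / suc n ≤ ε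
  1/n≤ ε@(mkℚ (+ suc p) d _) _ = d , subst (+ 1 / suc d ≤_) (ℚₚ.↥p/↧p≡p ε)
    (/-≤-/ (+ 1) (+ suc p) d d (ℤₚ.*-monoʳ-≤-nonNeg (+ suc d) {+ 1} {+ suc p} (ℤ.+≤+ (ℕ.s≤s ℕ.z≤n))))
  1/n≤ (mkℚ (+ zero) _ _)     (ℚ.*<* (ℤ.+<+ ()))
  1/n≤ (mkℚ (ℤ.-[1+ _ ]) _ _) (ℚ.*<* ())

open RationalLemmas

-- Reals are Cauchy sequences of rationals; the modulus of convergence is the ε ↦ N given by ∃.
Cauchy : (ℕ → ℚ) → Set
Cauchy x = ∀ ε → 0ℚ ℚ.< ε →
  ∃ λ N → ∀ m n → N ℕ.≤ m → N ℕ.≤ n → ℚ.∣ x m ℚ.- x n ∣ ℚ.≤ ε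

record ℝ : Set where
  constructor mkℝ
  field
    approx : ℕ → ℚ
    cauchy : Cauchy approx

open ℝ public

module CauchyLemmas where
  open import Data.Rational
  open +-*-Solver

  constᶜ : ∀ q → Cauchy (λ _ → q)
  constᶜ q ε 0<ε = 0 , λ _ _ _ _ → ℚₚ.≤-trans (ℚₚ.≤-reflexive (cong ∣_∣ (ℚₚ.+-inverseʳ q))) (ℚₚ.<⇒≤ 0<ε)

  negᶜ : ∀ x → Cauchy x → Cauchy (λ n → - x n)
  negᶜ x cx ε 0<ε = let N , h = cx ε 0<ε in N , λ m n N≤m N≤n →
    subst (_≤ ε)
          (trans (∣p-q∣≡∣q-p∣ (x m) (x n))
                 (cong ∣_∣ (solve 2 (λ p q → q :- p := :- p :- (:- q)) refl (x m) (x n))))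
          (h m n N≤m N≤n)

  absᶜ : ∀ x → Cauchy x → Cauchy (λ n → ∣ x n ∣)
  absᶜ x cx ε 0<ε = let N , h = cx ε 0<ε in N , λ m n N≤m N≤n →
    ℚₚ.≤-trans (∣∣p∣-∣q∣∣≤∣p-q∣ (x m) (x n)) (h m n N≤m N≤n)

  addᶜ : ∀ x y → Cauchy x → Cauchy y → Cauchy (λ n → x n + y n)
  addᶜ x y cx cy ε 0<ε =
    let 0<ε/2 = *-pos 0<ε (ℚₚ.positive⁻¹ ½)
        M , h = cx (ε * ½) 0<ε/2
        N , k = cy (ε * ½) 0<ε/2
    in M ℕ.⊔ N , λ m n le le′ → begin
    ∣ (x m + y m) - (x n + y n) ∣
      ≡⟨ cong ∣_∣ (solve 4 (λ p q r s → (p :+ q) :- (r :+ s) := (p :- r) :+ (q :- s))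
                         refl (x m) (y m) (x n) (y n)) ⟩
    ∣ (x m - x n) + (y m - y n) ∣
      ≤⟨ ℚₚ.∣p+q∣≤∣p∣+∣q∣ (x m - x n) (y m - y n) ⟩
    ∣ x m - x n ∣ + ∣ y m - y n ∣
      ≤⟨ ℚₚ.+-mono-≤ (h m n (ℕₚ.m⊔n≤o⇒m≤o M N le) (ℕₚ.m⊔n≤o⇒m≤o M N le′))
                     (k m n (ℕₚ.m⊔n≤o⇒n≤o M N le) (ℕₚ.m⊔n≤o⇒n≤o M N le′)) ⟩
    ε * ½ + ε * ½
      ≡⟨ solve 1 (λ e → e :* con ½ :+ e :* con ½ := e) refl ε ⟩
    ε ∎
    where open ℚₚ.≤-Reasoning

  bounded : ∀ x → Cauchy x → ∃ λ B → 0ℚ < B × ∃ λ N → ∀ n → N ℕ.≤ n → ∣ x n ∣ ≤ B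
  bounded x cx =
    let N , h = cx 1ℚ (ℚₚ.positive⁻¹ 1ℚ)
    in  ∣ x N ∣ + 1ℚ
      , ℚₚ.+-mono-≤-< (ℚₚ.0≤∣p∣ (x N)) (ℚₚ.positive⁻¹ 1ℚ)
      , N
      , λ n N≤n → ℚₚ.≤-trans (∣p∣≤∣q∣+∣p-q∣ (x n) (x N))
                             (ℚₚ.+-monoʳ-≤ ∣ x N ∣ (h n N N≤n ℕₚ.≤-refl))

  mul-close : ∀ p q r s A B δ → ∣ p ∣ ≤ A → ∣ s ∣ ≤ B → ∣ p - r ∣ ≤ δ → ∣ q - s ∣ ≤ δ →
              ∣ p * q - r * s ∣ ≤ (A + B) * δ
  mul-close p q r s A B δ ∣p∣≤A ∣s∣≤B p~r q~s = begin
    ∣ p * q - r * s ∣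
      ≡⟨ cong ∣_∣ (solve 4 (λ p q r s → p :* q :- r :* s := p :* (q :- s) :+ s :* (p :- r)) refl p q r s) ⟩
    ∣ p * (q - s) + s * (p - r) ∣
      ≤⟨ ℚₚ.∣p+q∣≤∣p∣+∣q∣ (p * (q - s)) (s * (p - r)) ⟩
    ∣ p * (q - s) ∣ + ∣ s * (p - r) ∣
      ≡⟨ cong₂ _+_ (ℚₚ.∣p*q∣≡∣p∣*∣q∣ p (q - s)) (ℚₚ.∣p*q∣≡∣p∣*∣q∣ s (p - r)) ⟩
    ∣ p ∣ * ∣ q - s ∣ + ∣ s ∣ * ∣ p - r ∣
      ≤⟨ ℚₚ.+-mono-≤
           (*-mono-≤ (ℚₚ.0≤∣p∣ (q - s)) (ℚₚ.≤-trans (ℚₚ.0≤∣p∣ p) ∣p∣≤A) ∣p∣≤A q~s)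
           (*-mono-≤ (ℚₚ.0≤∣p∣ (p - r)) (ℚₚ.≤-trans (ℚₚ.0≤∣p∣ s) ∣s∣≤B) ∣s∣≤B p~r) ⟩
    A * δ + B * δ
      ≡⟨ ℚₚ.*-distribʳ-+ δ A B ⟨
    (A + B) * δ ∎
    where open ℚₚ.≤-Reasoning

  split : ∀ C ε → 0ℚ < C → 0ℚ < ε → ∃ λ δ → 0ℚ < δ × C * δ ≡ ε
  split C ε 0<C 0<ε = 1/ C * ε , *-pos 0<1/C 0<ε , (begin
    C * (1/ C * ε)  ≡⟨ ℚₚ.*-assoc C (1/ C) ε ⟨
    C * 1/ C * ε    ≡⟨ cong (_* ε) (ℚₚ.*-inverseʳ C) ⟩
    1ℚ * ε          ≡⟨ ℚₚ.*-identityˡ ε ⟩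
    ε               ∎)
    where
    open ≡-Reasoning
    instance
      C>0 : Positive C
      C>0 = positive 0<C
      C≢0 : NonZero C
      C≢0 = ℚₚ.pos⇒nonZero C
    0<1/C : 0ℚ < 1/ C
    0<1/C = ℚₚ.positive⁻¹ (1/ C) {{ℚₚ.1/pos⇒pos C}}

  mulᶜ : ∀ x y → Cauchy x → Cauchy y → Cauchy (λ n → x n * y n)
  mulᶜ x y cx cy ε 0<ε =
    let A , 0<A , K , ∣x∣≤A = bounded x cx
        B , 0<B , L , ∣y∣≤B = bounded y cy
        δ , 0<δ , eq = split (A + B) ε (+-pos 0<A 0<B) 0<ε
        M , h = cx δ 0<δ
        N , k = cy δ 0<δ
    in K ℕ.⊔ L ℕ.⊔ M ℕ.⊔ N , λ m n le le′ →
      subst (∣ x m * y m - x n * y n ∣ ≤_) eq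
        (mul-close (x m) (y m) (x n) (y n) A B δ
          (∣x∣≤A m (toK K L M N le)) (∣y∣≤B n (toL K L M N le′))
          (h m n (toM K L M N le) (toM K L M N le′)) (k m n (toN K L M N le) (toN K L M N le′)))
    where
    toN : ∀ K L M N {n} → K ℕ.⊔ L ℕ.⊔ M ℕ.⊔ N ℕ.≤ n → N ℕ.≤ n
    toN K L M N le = ℕₚ.m⊔n≤o⇒n≤o (K ℕ.⊔ L ℕ.⊔ M) N le
    toKLM : ∀ K L M N {n} → K ℕ.⊔ L ℕ.⊔ M ℕ.⊔ N ℕ.≤ n → K ℕ.⊔ L ℕ.⊔ M ℕ.≤ n
    toKLM K L M N le = ℕₚ.m⊔n≤o⇒m≤o (K ℕ.⊔ L ℕ.⊔ M) N le
    toM : ∀ K L M N {n} → K ℕ.⊔ L ℕ.⊔ M ℕ.⊔ N ℕ.≤ n → M ℕ.≤ n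
    toM K L M N le = ℕₚ.m⊔n≤o⇒n≤o (K ℕ.⊔ L) M (toKLM K L M N le)
    toK : ∀ K L M N {n} → K ℕ.⊔ L ℕ.⊔ M ℕ.⊔ N ℕ.≤ n → K ℕ.≤ n
    toK K L M N le = ℕₚ.m⊔n≤o⇒m≤o K L (ℕₚ.m⊔n≤o⇒m≤o (K ℕ.⊔ L) M (toKLM K L M N le))
    toL : ∀ K L M N {n} → K ℕ.⊔ L ℕ.⊔ M ℕ.⊔ N ℕ.≤ n → L ℕ.≤ n
    toL K L M N le = ℕₚ.m⊔n≤o⇒n≤o K L (ℕₚ.m⊔n≤o⇒m≤o (K ℕ.⊔ L) M (toKLM K L M N le))

  -- The value at 0 is immaterial: a real apart from 0 has eventually nonzero approximations.
  recip : ℚ → ℚ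
  recip q with q ℚₚ.≟ 0ℚ
  ... | yes _  = 0ℚ
  ... | no q≢0 = (1/ q) {{≢-nonZero q≢0}}

  recip-inverse : ∀ q → q ≢ 0ℚ → q * recip q ≡ 1ℚ
  recip-inverse q q≢0 with q ℚₚ.≟ 0ℚ
  ... | yes q≡0 = contradiction q≡0 q≢0
  ... | no q≢0′ = ℚₚ.*-inverseʳ q {{≢-nonZero q≢0′}}

  recipᶜ : ∀ x → Cauchy x → ∀ δ → 0ℚ < δ → ∀ K → (∀ n → K ℕ.≤ n → δ ≤ ∣ x n ∣) →
           Cauchy (λ n → recip (x n))
  recipᶜ x cx δ 0<δ K δ≤∣x∣ ε 0<ε =
    let N , h = cx (ε * (δ * δ)) (*-pos 0<ε (*-pos 0<δ 0<δ)) in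
    K ℕ.⊔ N , λ m n le le′ →
    bound m n (ℕₚ.m⊔n≤o⇒m≤o K N le) (ℕₚ.m⊔n≤o⇒m≤o K N le′)
              (h m n (ℕₚ.m⊔n≤o⇒n≤o K N le) (ℕₚ.m⊔n≤o⇒n≤o K N le′))
    where
    x≢0 : ∀ n → K ℕ.≤ n → x n ≢ 0ℚ
    x≢0 n K≤n eq =
      ℚₚ.<-irrefl refl (ℚₚ.<-≤-trans 0<δ (subst (λ q → δ ≤ ∣ q ∣) eq (δ≤∣x∣ n K≤n)))

    bound : ∀ m n → K ℕ.≤ m → K ℕ.≤ n → ∣ x m - x n ∣ ≤ ε * (δ * δ) →
            ∣ recip (x m) - recip (x n) ∣ ≤ ε
    bound m n K≤m K≤n le = ℚₚ.*-cancelʳ-≤-pos (δ * δ) {{positive (*-pos 0<δ 0<δ)}} (begin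
      D * (δ * δ)
        ≤⟨ ℚₚ.*-monoˡ-≤-nonNeg D {{ℚₚ.∣-∣-nonNeg (u - v)}}
             (*-mono-≤ (ℚₚ.<⇒≤ 0<δ) (ℚₚ.0≤∣p∣ a) (δ≤∣x∣ m K≤m) (δ≤∣x∣ n K≤n)) ⟩
      D * (∣ a ∣ * ∣ b ∣)
        ≡⟨ cong (D *_) (ℚₚ.∣p*q∣≡∣p∣*∣q∣ a b) ⟨
      D * ∣ a * b ∣
        ≡⟨ ℚₚ.∣p*q∣≡∣p∣*∣q∣ (u - v) (a * b) ⟨
      ∣ (u - v) * (a * b) ∣
        ≡⟨ cong ∣_∣ (solve 4 (λ p q r s → (r :- s) :* (p :* q) := (p :* r) :* q :- (q :* s) :* p)
                           refl a b u v) ⟩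
      ∣ (a * u) * b - (b * v) * a ∣
        ≡⟨ cong₂ (λ p q → ∣ p * b - q * a ∣) (recip-inverse a (x≢0 m K≤m)) (recip-inverse b (x≢0 n K≤n)) ⟩
      ∣ 1ℚ * b - 1ℚ * a ∣
        ≡⟨ cong₂ (λ p q → ∣ p - q ∣) (ℚₚ.*-identityˡ b) (ℚₚ.*-identityˡ a) ⟩
      ∣ b - a ∣
        ≡⟨ ∣p-q∣≡∣q-p∣ b a ⟩
      ∣ a - b ∣
        ≤⟨ le ⟩
      ε * (δ * δ) ∎)
      where
      open ℚₚ.≤-Reasoning
      a b u v D : ℚ
      a = x m
      b = x n
      u = recip a
      v = recip b
      D = ∣ u - v ∣

open CauchyLemmas

infix  4 _<ᴿ_
infixl 6 _+ᴿ_ _-ᴿ_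
infixl 7 _*ᴿ_
infix  8 -ᴿ_

fromℚ : ℚ → ℝ
fromℚ q = mkℝ (λ _ → q) (constᶜ q)

_+ᴿ_ : ℝ → ℝ → ℝ
x +ᴿ y = mkℝ (λ n → approx x n ℚ.+ approx y n) (addᶜ (approx x) (approx y) (cauchy x) (cauchy y))

-ᴿ_ : ℝ → ℝ
-ᴿ x = mkℝ (λ n → ℚ.- approx x n) (negᶜ (approx x) (cauchy x))

_-ᴿ_ : ℝ → ℝ → ℝ
x -ᴿ y = x +ᴿ -ᴿ y

_*ᴿ_ : ℝ → ℝ → ℝ
x *ᴿ y = mkℝ (λ n → approx x n ℚ.* approx y n) (mulᶜ (approx x) (approx y) (cauchy x) (cauchy y))

∣_∣ᴿ : ℝ → ℝ
∣ x ∣ᴿ = mkℝ (λ n → ℚ.∣ approx x n ∣) (absᶜ (approx x) (cauchy x))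

_<ᴿ_ : ℝ → ℝ → Set
x <ᴿ y = ∃ λ δ → 0ℚ ℚ.< δ × ∃ λ N → ∀ n → N ℕ.≤ n → approx x n ℚ.+ δ ℚ.≤ approx y n

-- Constructively, inverting a real needs apartness from zero, not merely x ≠ 0.
Apart₀ : ℝ → Set
Apart₀ x = fromℚ 0ℚ <ᴿ ∣ x ∣ᴿ

inverse : (x : ℝ) → Apart₀ x → ℝ
inverse x (δ , 0<δ , N , h) = mkℝ (λ n → recip (approx x n))
  (recipᶜ (approx x) (cauchy x) δ 0<δ N (λ n N≤n → subst (ℚ._≤ _) (ℚₚ.+-identityˡ δ) (h n N≤n)))

divide : (x y : ℝ) → Apart₀ y → ℝ
divide x y y#0 = x *ᴿ inverse y y#0

zetaSum : ℕ → ℕ → ℚ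
zetaSum s zero    = 0ℚ
zetaSum s (suc n) = zetaSum s n ℚ.+ (+ 1 ℚ./ (suc n ℕ.^ s)) {{ℕₚ.m^n≢0 (suc n) s}}

module ZetaLemmas where
  open import Data.Rational
  open +-*-Solver

  zetaSum-mono : ∀ s {m n} → m ℕ.≤′ n → zetaSum s m ≤ zetaSum s n
  zetaSum-mono s ℕ.≤′-refl = ℚₚ.≤-refl
  zetaSum-mono s {m} {suc n} (ℕ.≤′-step m≤n) = begin
    zetaSum s m         ≤⟨ zetaSum-mono s m≤n ⟩
    zetaSum s n         ≡⟨ ℚₚ.+-identityʳ (zetaSum s n) ⟨
    zetaSum s n + 0ℚ    ≤⟨ ℚₚ.+-monoʳ-≤ (zetaSum s n) (0≤1/n (suc n ℕ.^ s) {{ℕₚ.m^n≢0 (suc n) s}}) ⟩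
    zetaSum s (suc n)   ∎
    where open ℚₚ.≤-Reasoning

  -- The partial sums plus 1/n decrease, since 1/(n+1)^s ≤ 1/n − 1/(n+1).
  zetaSum+1/n-anti : ∀ s → 2 ℕ.≤ s → ∀ {m n} → m ℕ.≤′ n →
    zetaSum s (suc n) + (+ 1 / suc n) ≤ zetaSum s (suc m) + (+ 1 / suc m)
  zetaSum+1/n-anti s 2≤s ℕ.≤′-refl = ℚₚ.≤-refl
  zetaSum+1/n-anti s@(suc (suc t)) 2≤s@(ℕ.s≤s (ℕ.s≤s _)) {m} {suc k} (ℕ.≤′-step m≤k) = begin
    (S + (+ 1 / (suc n ℕ.^ s))) + (+ 1 / suc n)
      ≤⟨ ℚₚ.+-monoˡ-≤ (+ 1 / suc n) (ℚₚ.+-monoʳ-≤ S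
           (1/-anti-≤ (suc n ℕ.^ s) (suc n ℕ.* n) (ℕₚ.*-monoʳ-≤ (suc n) n≤))) ⟩
    (S + (+ 1 / (suc n ℕ.* n))) + (+ 1 / suc n)
      ≡⟨ solve 3 (λ p q r → (p :+ q) :+ r := p :+ (r :+ q)) refl S (+ 1 / (suc n ℕ.* n)) (+ 1 / suc n) ⟩
    S + ((+ 1 / suc n) + (+ 1 / (suc n ℕ.* n)))
      ≡⟨ cong (λ z → S + z) (1/[1+n]+1/n[1+n]≡1/n n) ⟩
    S + (+ 1 / n)
      ≤⟨ zetaSum+1/n-anti s 2≤s m≤k ⟩
    zetaSum s (suc m) + (+ 1 / suc m)
      ∎
    where
    open ℚₚ.≤-Reasoning
    n = suc k
    S = zetaSum s n
    instance
      [1+n]^s≢0 : ℕ.NonZero (suc n ℕ.^ s)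
      [1+n]^s≢0 = ℕₚ.m^n≢0 (suc n) s
    n≤ : n ℕ.≤ suc n ℕ.^ suc t
    n≤ = ℕₚ.≤-trans (ℕₚ.n≤1+n n) (ℕₚ.m≤m*n (suc n) (suc n ℕ.^ t) {{ℕₚ.m^n≢0 (suc n) t}})

  zetaSum-tail : ∀ s → 2 ℕ.≤ s → ∀ N m n → N ℕ.≤ m → m ℕ.≤ n →
    ∣ zetaSum s (suc n) - zetaSum s (suc m) ∣ ≤ + 1 / suc N
  zetaSum-tail s 2≤s N m n N≤m m≤n = begin
    ∣ Sₙ - Sₘ ∣
      ≡⟨ ℚₚ.0≤p⇒∣p∣≡p (subst (_≤ Sₙ - Sₘ) (ℚₚ.+-inverseʳ Sₘ)
           (ℚₚ.+-monoˡ-≤ (- Sₘ) (zetaSum-mono s (ℕₚ.≤⇒≤′ (ℕ.s≤s m≤n))))) ⟩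
    Sₙ - Sₘ
      ≡⟨ cong (_- Sₘ) (ℚₚ.+-identityʳ Sₙ) ⟨
    (Sₙ + 0ℚ) - Sₘ
      ≤⟨ ℚₚ.+-monoˡ-≤ (- Sₘ) (ℚₚ.+-monoʳ-≤ Sₙ (0≤1/n (suc n))) ⟩
    (Sₙ + (+ 1 / suc n)) - Sₘ
      ≤⟨ ℚₚ.+-monoˡ-≤ (- Sₘ) (zetaSum+1/n-anti s 2≤s (ℕₚ.≤⇒≤′ m≤n)) ⟩
    (Sₘ + (+ 1 / suc m)) - Sₘ
      ≡⟨ solve 2 (λ p q → (p :+ q) :- p := q) refl Sₘ (+ 1 / suc m) ⟩
    + 1 / suc m
      ≤⟨ 1/-anti-≤ (suc m) (suc N) (ℕ.s≤s N≤m) ⟩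
    + 1 / suc N
      ∎
    where
    open ℚₚ.≤-Reasoning
    Sₙ = zetaSum s (suc n)
    Sₘ = zetaSum s (suc m)

  zetaSum-cauchy : ∀ s → 2 ℕ.≤ s → Cauchy (zetaSum s)
  zetaSum-cauchy s 2≤s ε 0<ε = let N , 1/N≤ε = 1/n≤ ε 0<ε in suc N , close N 1/N≤ε
    where
    close : ∀ N → + 1 / suc N ≤ ε → ∀ m n → suc N ℕ.≤ m → suc N ℕ.≤ n → ∣ zetaSum s m - zetaSum s n ∣ ≤ ε
    close N 1/N≤ε (suc m) (suc n) (ℕ.s≤s N≤m) (ℕ.s≤s N≤n) with ℕₚ.≤-total m n
    ... | inj₁ m≤n = subst (_≤ ε) (∣p-q∣≡∣q-p∣ (zetaSum s (suc n)) (zetaSum s (suc m)))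
                       (ℚₚ.≤-trans (zetaSum-tail s 2≤s N m n N≤m m≤n) 1/N≤ε)
    ... | inj₂ n≤m = ℚₚ.≤-trans (zetaSum-tail s 2≤s N n m N≤n n≤m) 1/N≤ε

open ZetaLemmas

-- The Riemann zeta function at an integer s ≥ 2, where it is given by its Dirichlet series.
ζ : (s : ℕ) → 2 ℕ.≤ s → ℝ
ζ s 2≤s = mkℝ (zetaSum s) (zetaSum-cauchy s 2≤s)

ζ3 : ℝ
ζ3 = ζ 3 (ℕ.s≤s (ℕ.s≤s ℕ.z≤n))

7ζ3 : ℝ
7ζ3 = fromℚ (+ 7 ℚ./ 1) *ᴿ ζ3

7ζ3#0 : Apart₀ 7ζ3
7ζ3#0 = + 7 / 1 , ℚₚ.positive⁻¹ (+ 7 / 1) , 1 , λ n 1≤n →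
  ℚₚ.≤-trans (ℚₚ.*-monoˡ-≤-nonNeg (+ 7 / 1) (zetaSum-mono 3 (ℕₚ.≤⇒≤′ 1≤n))) (p≤∣p∣ _)
  where open import Data.Rational

-- U_n = a_n U_{n-1} + b_n U_{n-2} (n ≥ 1) with U_{-1} = u₋₁ and U_0 = u₀; the result is
-- n ↦ U_n for n ≥ 0.  The value b 0 is never used.
recurrence : (a b : ℕ → ℚ) (u₋₁ u₀ : ℚ) → ℕ → ℚ
recurrence a b u₋₁ u₀ zero          = u₀
recurrence a b u₋₁ u₀ (suc zero)    = a 1 ℚ.* u₀ ℚ.+ b 1 ℚ.* u₋₁
recurrence a b u₋₁ u₀ (suc (suc n)) =
  a (suc (suc n)) ℚ.* recurrence a b u₋₁ u₀ (suc n) ℚ.+ b (suc (suc n)) ℚ.* recurrence a b u₋₁ u₀ n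

P Q : (a b : ℕ → ℚ) → ℕ → ℚ
P a b = recurrence a b 1ℚ (a 0)
Q a b = recurrence a b 0ℚ 1ℚ

convergent : (a b : ℕ → ℚ) (n : ℕ) → Q a b n ≢ 0ℚ → ℚ
convergent a b n Qₙ≢0 = (P a b n ℚ.÷ Q a b n) {{ℚ.≢-nonZero Qₙ≢0}}

-- P_n/Q_n → v, which includes that P_n/Q_n is defined for all large n.
PCF-ConvergesTo : (a b : ℕ → ℚ) → ℝ → Set
PCF-ConvergesTo a b v = ∀ ε → 0ℚ ℚ.< ε → ∃ λ N → ∀ n → N ℕ.≤ n →
  Σ (Q a b n ≢ 0ℚ) λ Qₙ≢0 → ∣ fromℚ (convergent a b n Qₙ≢0) -ᴿ v ∣ᴿ <ᴿ fromℚ ε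

module Submission where

open import Defs

-- The numerators are P_n = N!³ D_N / 2ᴺ with N = n + 1 and D_N the Domb numbers.  A third solution
-- of the recurrence is Σ R_N(t) over the half-integers t = m + 1/2, m ≥ 0, where
--   R_N(t) = (N!⁵ / 2ᴺ) · ∏_{i ≤ 2N} (2t+i) / ∏_{j ≤ N} (t+j)⁴ :
-- the terms satisfy the recurrence up to a telescoping difference whose boundary terms vanish.
-- For N = 0 the series is Σ 16/(2m+1)³ = 14 ζ(3), and for N = 1 it is 28 ζ(3) − 24; hence it
-- equals 14 ζ(3) P_n − 24 Q_n.  It is O(2ᴺ N!³), whereas P_n is at least a multiple of 3ᴺ N!³, so
-- 24 Q_n / P_n → 14 ζ(3).

-- After division by N!³ the recurrence has limiting characteristic polynomial λ² - 10λ + 16 = (λ -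
-- 2)(λ - 8). The series belongs to the root 2 and P to the root 8. To leading order a lower bound c
-- for the normalised ratio is inherited when 10 - 16/c ≥ c, that is for 2 ≤ c ≤ 8; the value 3
-- leaves a gap above 2 and is already met by the first terms. Infinite series are replaced
-- throughout by sums of M terms, since ζ(3) itself is given as the Cauchy sequence of its partial
-- sums. The recurrence and the linear form then hold up to O(1/M), with constants that depend on n.
-- This dependence is harmless: `_<ᴿ_` speaks of late approximations for one fixed convergent, so n
-- is fixed before M tends to infinity. Only the comparison of the series with P has to be uniform
-- in M.

module Naturals where
  open import Data.Nat as ℕ using (ℕ; suc)
  import Data.Nat.Properties as ℕₚ
  open import Data.Integer as ℤ using (+_)
  import Data.Integer.Properties as ℤₚ
  open import Data.Rational
  import Data.Rational.Properties as ℚₚ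
  import Data.Rational.Unnormalised as ℚᵘ
  import Data.Rational.Unnormalised.Properties as ℚᵘₚ
  open import Relation.Binary.PropositionalEquality

  ι : ℕ → ℚ
  ι n = + n / 1

  toℚᵘ-ι : ∀ n → toℚᵘ (ι n) ℚᵘ.≃ ℚᵘ.mkℚᵘ (+ n) 0
  toℚᵘ-ι n = ℚₚ.toℚᵘ-fromℚᵘ (ℚᵘ.mkℚᵘ (+ n) 0)

  ι-+ : ∀ m n → ι (m ℕ.+ n) ≡ ι m + ι n
  ι-+ m n = ℚₚ.toℚᵘ-injective (begin-equality
    toℚᵘ (ι (m ℕ.+ n))            ≃⟨ toℚᵘ-ι (m ℕ.+ n) ⟩
    ℚᵘ.mkℚᵘ (+ (m ℕ.+ n)) 0       ≃⟨ ℚᵘ.*≡* (cong (ℤ._* + 1)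
                                        (cong₂ ℤ._+_ (ℤₚ.*-identityʳ (+ m)) (ℤₚ.*-identityʳ (+ n)))) ⟨
    ℚᵘ.mkℚᵘ (+ m) 0 ℚᵘ.+ ℚᵘ.mkℚᵘ (+ n) 0
                                  ≃⟨ ℚᵘₚ.+-cong (toℚᵘ-ι m) (toℚᵘ-ι n) ⟨
    toℚᵘ (ι m) ℚᵘ.+ toℚᵘ (ι n)    ≃⟨ ℚₚ.toℚᵘ-homo-+ (ι m) (ι n) ⟨
    toℚᵘ (ι m + ι n)              ∎)
    where open ℚᵘₚ.≤-Reasoning

  ι-* : ∀ m n → ι (m ℕ.* n) ≡ ι m * ι n
  ι-* m n = ℚₚ.toℚᵘ-injective (begin-equality
    toℚᵘ (ι (m ℕ.* n))            ≃⟨ toℚᵘ-ι (m ℕ.* n) ⟩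
    ℚᵘ.mkℚᵘ (+ (m ℕ.* n)) 0       ≃⟨ ℚᵘ.*≡* (cong (ℤ._* + 1) (ℤₚ.pos-* m n)) ⟩
    ℚᵘ.mkℚᵘ (+ m) 0 ℚᵘ.* ℚᵘ.mkℚᵘ (+ n) 0
                                  ≃⟨ ℚᵘₚ.*-cong (toℚᵘ-ι m) (toℚᵘ-ι n) ⟨
    toℚᵘ (ι m) ℚᵘ.* toℚᵘ (ι n)    ≃⟨ ℚₚ.toℚᵘ-homo-* (ι m) (ι n) ⟨
    toℚᵘ (ι m * ι n)              ∎)
    where open ℚᵘₚ.≤-Reasoning

  ι-suc : ∀ n → ι (suc n) ≡ ι n + 1ℚ
  ι-suc n = trans (ι-+ 1 n) (ℚₚ.+-comm 1ℚ (ι n))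

  0≤ι : ∀ n → 0ℚ ≤ ι n
  0≤ι n = ℚₚ.nonNegative⁻¹ (ι n) {{ℚₚ.normalize-nonNeg n 1}}

  inv : ℕ → ℚ
  inv n = + 1 / suc n

  0≤inv : ∀ n → 0ℚ ≤ inv n
  0≤inv n = ℚₚ.nonNegative⁻¹ (inv n) {{ℚₚ.normalize-nonNeg 1 (suc n)}}

  ι*inv : ∀ n → ι (suc n) * inv n ≡ 1ℚ
  ι*inv n = ℚₚ.toℚᵘ-injective (begin-equality
    toℚᵘ (ι (suc n) * inv n)      ≃⟨ ℚₚ.toℚᵘ-homo-* (ι (suc n)) (inv n) ⟩
    toℚᵘ (ι (suc n)) ℚᵘ.* toℚᵘ (inv n)
                                  ≃⟨ ℚᵘₚ.*-cong (toℚᵘ-ι (suc n)) (ℚₚ.toℚᵘ-fromℚᵘ (ℚᵘ.mkℚᵘ (+ 1) n)) ⟩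
    ℚᵘ.mkℚᵘ (+ suc n) 0 ℚᵘ.* ℚᵘ.mkℚᵘ (+ 1) n
                                  ≃⟨ ℚᵘ.*≡* (trans (ℤₚ.*-comm (+ suc n ℤ.* + 1) (+ 1))
                                        (cong (λ k → + 1 ℤ.* + k) (ℕₚ.*-comm (suc n) 1))) ⟩
    ℚᵘ.1ℚᵘ                        ∎)
    where open ℚᵘₚ.≤-Reasoning

-- Order lemmas and sequences of size O(1/n).

module Estimates where
  open import Data.Nat as ℕ using (ℕ; suc)
  open import Data.Product using (∃; _×_; _,_)
  open import Data.Rational
  import Data.Rational.Properties as ℚₚ
  open import Relation.Binary.PropositionalEquality
  open RationalLemmas
  open CauchyLemmas using (split)
  open Naturals

  +-nonNeg : ∀ {p q} → 0ℚ ≤ p → 0ℚ ≤ q → 0ℚ ≤ p + q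
  +-nonNeg = ℚₚ.+-mono-≤

  *-nonNeg : ∀ {p q} → 0ℚ ≤ p → 0ℚ ≤ q → 0ℚ ≤ p * q
  *-nonNeg {p} {q} 0≤p 0≤q = subst (_≤ p * q) (ℚₚ.*-zeroʳ p)
    (ℚₚ.*-monoˡ-≤-nonNeg p {{nonNegative 0≤p}} 0≤q)

  *-≤1 : ∀ {p q} → 0ℚ ≤ q → p ≤ 1ℚ → q ≤ 1ℚ → p * q ≤ 1ℚ
  *-≤1 {p} {q} 0≤q p≤1 q≤1 = *-mono-≤ 0≤q (ℚₚ.nonNegative⁻¹ 1ℚ) p≤1 q≤1

  *-shrink : ∀ {p q} → 0ℚ ≤ q → p ≤ 1ℚ → p * q ≤ q
  *-shrink {p} {q} 0≤q p≤1 = subst (p * q ≤_) (ℚₚ.*-identityˡ q)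
    (ℚₚ.*-monoʳ-≤-nonNeg q {{nonNegative 0≤q}} p≤1)

  p≤p+q : ∀ {p q} → 0ℚ ≤ q → p ≤ p + q
  p≤p+q {p} {q} 0≤q = subst (_≤ p + q) (ℚₚ.+-identityʳ p) (ℚₚ.+-monoʳ-≤ p 0≤q)

  0≤q-p : ∀ {p q} → p ≤ q → 0ℚ ≤ q - p
  0≤q-p {p} {q} p≤q = subst (_≤ q - p) (ℚₚ.+-inverseʳ p) (ℚₚ.+-monoˡ-≤ (- p) p≤q)

  ∣nonNeg∣ : ∀ {p q} → 0ℚ ≤ p → p ≤ q → ∣ p ∣ ≤ q
  ∣nonNeg∣ {q = q} 0≤p p≤q = subst (_≤ q) (sym (ℚₚ.0≤p⇒∣p∣≡p 0≤p)) p≤q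

  Bounded : (ℕ → ℚ) → Set
  Bounded f = ∃ λ B → ∀ n → ∣ f n ∣ ≤ B

  -- An explicit rate instead of a bare limit 0: sums and bounded multiples then only add or
  -- multiply constants.
  O[1/n] : (ℕ → ℚ) → Set
  O[1/n] f = ∃ λ C → ∀ n → ∣ f n ∣ ≤ C * inv n

  bounded-const : ∀ c → Bounded (λ _ → c)
  bounded-const c = ∣ c ∣ , λ _ → ℚₚ.≤-refl

  bounded-neg : ∀ {f} → Bounded f → Bounded (λ n → - f n)
  bounded-neg {f} (B , h) = B , λ n → subst (_≤ B) (sym (ℚₚ.∣-p∣≡∣p∣ (f n))) (h n)

  bounded-+ : ∀ {f g} → Bounded f → Bounded g → Bounded (λ n → f n + g n)
  bounded-+ {f} {g} (B , h) (C , k) = B + C , λ n →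
    ℚₚ.≤-trans (ℚₚ.∣p+q∣≤∣p∣+∣q∣ (f n) (g n)) (ℚₚ.+-mono-≤ (h n) (k n))

  bounded-* : ∀ {f g} → Bounded f → Bounded g → Bounded (λ n → f n * g n)
  bounded-* {f} {g} (B , h) (C , k) = B * C , λ n →
    subst (_≤ B * C) (sym (ℚₚ.∣p*q∣≡∣p∣*∣q∣ (f n) (g n)))
      (*-mono-≤ (ℚₚ.0≤∣p∣ (g n)) (ℚₚ.≤-trans (ℚₚ.0≤∣p∣ (f n)) (h n)) (h n) (k n))

  O-cong : ∀ {f g} → (∀ n → f n ≡ g n) → O[1/n] f → O[1/n] g
  O-cong f≗g (C , h) = C , λ n → subst (λ p → ∣ p ∣ ≤ C * inv n) (f≗g n) (h n)

  O-neg : ∀ {f} → O[1/n] f → O[1/n] (λ n → - f n)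
  O-neg {f} (C , h) = C , λ n → subst (_≤ C * inv n) (sym (ℚₚ.∣-p∣≡∣p∣ (f n))) (h n)

  O-+ : ∀ {f g} → O[1/n] f → O[1/n] g → O[1/n] (λ n → f n + g n)
  O-+ {f} {g} (B , h) (C , k) = B + C , λ n →
    subst (∣ f n + g n ∣ ≤_) (sym (ℚₚ.*-distribʳ-+ (inv n) B C))
      (ℚₚ.≤-trans (ℚₚ.∣p+q∣≤∣p∣+∣q∣ (f n) (g n)) (ℚₚ.+-mono-≤ (h n) (k n)))

  O-* : ∀ {f g} → Bounded f → O[1/n] g → O[1/n] (λ n → f n * g n)
  O-* {f} {g} (B , h) (C , k) = B * C , λ n →
    subst₂ _≤_ (sym (ℚₚ.∣p*q∣≡∣p∣*∣q∣ (f n) (g n))) (sym (ℚₚ.*-assoc B C (inv n)))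
      (*-mono-≤ (ℚₚ.0≤∣p∣ (g n)) (ℚₚ.≤-trans (ℚₚ.0≤∣p∣ (f n)) (h n)) (h n) (k n))

  O-scale : ∀ c {f} → O[1/n] f → O[1/n] (λ n → c * f n)
  O-scale c = O-* (bounded-const c)

  inv-anti : ∀ {m n} → m ℕ.≤ n → inv n ≤ inv m
  inv-anti {m} {n} m≤n = 1/-anti-≤ (suc n) (suc m) (ℕ.s≤s m≤n)

  O⇒eventually : ∀ {f} → O[1/n] f → ∀ ε → 0ℚ < ε → ∃ λ N → ∀ n → N ℕ.≤ n → ∣ f n ∣ ≤ ε
  O⇒eventually {f} (C , h) ε 0<ε =
    -- `C` may be zero or negative, while `split` divides by a positive number.
    let C′        = ∣ C ∣ + 1ℚ
        0<C′      = ℚₚ.+-mono-≤-< (ℚₚ.0≤∣p∣ C) (ℚₚ.positive⁻¹ 1ℚ)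
        δ , 0<δ , C′δ≡ε = split C′ ε 0<C′ 0<ε
        N , 1/N≤δ = 1/n≤ δ 0<δ
        C≤C′      = ℚₚ.≤-trans (p≤∣p∣ C) (p≤p+q (ℚₚ.nonNegative⁻¹ 1ℚ))
    in  N , λ n N≤n → ℚₚ.≤-trans (h n) (subst (C * inv n ≤_) C′δ≡ε
          (*-mono-≤ (0≤inv n) (ℚₚ.<⇒≤ 0<C′) C≤C′ (ℚₚ.≤-trans (inv-anti N≤n) 1/N≤δ)))

  ∑ : (ℕ → ℚ) → ℕ → ℚ
  ∑ f ℕ.zero  = 0ℚ
  ∑ f (suc n) = ∑ f n + f n

  ∑-nonNeg : ∀ {f} → (∀ m → 0ℚ ≤ f m) → ∀ n → 0ℚ ≤ ∑ f n
  ∑-nonNeg 0≤f ℕ.zero  = ℚₚ.≤-refl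
  ∑-nonNeg 0≤f (suc n) = +-nonNeg (∑-nonNeg 0≤f n) (0≤f n)

  ∑-mono : ∀ c {f g} → (∀ m → f m ≤ c * g m) → ∀ n → ∑ f n ≤ c * ∑ g n
  ∑-mono c f≤cg ℕ.zero  = ℚₚ.≤-reflexive (sym (ℚₚ.*-zeroʳ c))
  ∑-mono c {f} {g} f≤cg (suc n) = subst (∑ f n + f n ≤_) (sym (ℚₚ.*-distribˡ-+ c (∑ g n) (g n)))
    (ℚₚ.+-mono-≤ (∑-mono c f≤cg n) (f≤cg n))

-- The polynomial identity behind creative telescoping.

module Telescoping where
  open import Data.Nat using (ℕ)
  open import Data.Rational
  import Data.Rational.Properties as ℚₚ
  open import Data.Rational.Solver using (module +-*-Solver)
  open import Relation.Binary.PropositionalEquality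
  open +-*-Solver
  open Naturals

  cube : ℚ → ℚ
  cube t = t * t * t

  quint : ℚ → ℚ
  quint t = cube t * (t * t)

  odd : ℚ → ℚ
  odd t = ι 2 * t + 1ℚ

  α : ℚ → ℚ
  α t = (ι 2 * t + 1ℚ) * (ι 5 * (t * t) + ι 5 * t + ι 2)

  -- The polynomial part of the Gosper–Zeilberger certificate, with x standing for n + m.
  π : ℚ → ℚ → ℚ
  π n x = 1ℚ - (ι 2 * (n * n) + ι 7 * n + ι 2) * x - ι 6 * (n + 1ℚ) * (x * x) - ι 4 * cube x

  c : ∀ {n} → ℕ → Polynomial n
  c k = con (ι k)

  cubeₚ quintₚ oddₚ αₚ : ∀ {n} → Polynomial n → Polynomial n
  cubeₚ t = t :* t :* t
  quintₚ t = cubeₚ t :* (t :* t)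
  oddₚ t = c 2 :* t :+ c 1
  αₚ t = (c 2 :* t :+ c 1) :* (c 5 :* (t :* t) :+ c 5 :* t :+ c 2)

  πₚ : ∀ {n} → Polynomial n → Polynomial n → Polynomial n
  πₚ n x = c 1 :- (c 2 :* (n :* n) :+ c 7 :* n :+ c 2) :* x :- c 6 :* (n :+ c 1) :* (x :* x) :- c 4 :* cubeₚ x

  -- This is the telescoping relation with the common factor 16n⁵ · `y k m` divided out and the
  -- denominators odd(x)³ · odd(x + 1)³ cleared, hence a polynomial identity in two variables.
  certificate : ∀ n m → let x = n + m in
    ι 16 * quint (n + 1ℚ) * (x * (x + 1ℚ)) - α n * x * cube (odd (x + 1ℚ))
      + n * cube (odd x) * cube (odd (x + 1ℚ))
    ≡ x * cube (odd m) * π n (x + 1ℚ) - m * π n x * cube (odd (x + 1ℚ))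
  certificate = solve 2 (λ n m → let x = n :+ m in
    c 16 :* quintₚ (n :+ c 1) :* (x :* (x :+ c 1)) :- αₚ n :* x :* cubeₚ (oddₚ (x :+ c 1))
      :+ n :* cubeₚ (oddₚ x) :* cubeₚ (oddₚ (x :+ c 1))
    := x :* cubeₚ (oddₚ m) :* πₚ n (x :+ c 1) :- m :* πₚ n x :* cubeₚ (oddₚ (x :+ c 1))) refl

  -- Here j and l are the inverses of odd x and odd (x + 1); inserting the factors (odd x · j)³ and
  -- (odd (x + 1) · l)³ brings all terms to a common denominator, where only certificate remains.
  telescoping-algebra : ∀ A n m j l → let x = n + m in
    odd x * j ≡ 1ℚ → odd (x + 1ℚ) * l ≡ 1ℚ →
    let y₁ = A * (ι 16 * quint n * (x * cube j))
        y₂ = y₁ * (ι 16 * quint (n + 1ℚ) * ((x + 1ℚ) * cube l))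
    in  y₂ - α n * y₁ + ι 16 * (cube n * cube n) * A
        ≡ ι 16 * quint n * π n (x + 1ℚ) * cube l * (A * x * cube (odd m) * cube j)
          - ι 16 * quint n * π n x * cube j * (m * A)
  telescoping-algebra A n m j l rj≡1 sl≡1 = begin
    y₂ - α n * y₁ + ι 16 * (cube n * cube n) * A
      ≡⟨ solve 8 (λ A n x u N j l a →
           let y₁ = A :* (c 16 :* quintₚ n :* (x :* cubeₚ j)) in
           y₁ :* (c 16 :* N :* (u :* cubeₚ l)) :- a :* y₁ :+ c 16 :* (cubeₚ n :* cubeₚ n) :* A
           := A :* (c 16 :* quintₚ n) :* (cubeₚ j :* cubeₚ l :* (c 16 :* N :* (x :* u))
                :- a :* x :* (cubeₚ j :* cubeₚ (c 1)) :+ n :* (cubeₚ (c 1) :* cubeₚ (c 1))))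
           refl A n x u (quint (n + 1ℚ)) j l (α n) ⟩
    E 1ℚ 1ℚ
      ≡⟨ cong₂ E rj≡1 sl≡1 ⟨
    E (r * j) (s * l)
      ≡⟨ solve 9 (λ B n x j l a r s K →
           B :* (cubeₚ j :* cubeₚ l :* K :- a :* x :* (cubeₚ j :* cubeₚ (s :* l))
                :+ n :* (cubeₚ (r :* j) :* cubeₚ (s :* l)))
           := B :* (cubeₚ j :* cubeₚ l) :* (K :- a :* x :* cubeₚ s :+ n :* cubeₚ r :* cubeₚ s))
           refl (A * (ι 16 * quint n)) n x j l (α n) r s (ι 16 * quint (n + 1ℚ) * (x * u)) ⟩
    A * (ι 16 * quint n) * (cube j * cube l) *
      (ι 16 * quint (n + 1ℚ) * (x * u) - α n * x * cube s + n * cube r * cube s)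
      ≡⟨ cong (A * (ι 16 * quint n) * (cube j * cube l) *_) (certificate n m) ⟩
    A * (ι 16 * quint n) * (cube j * cube l) *
      (x * cube (odd m) * π n u - m * π n x * cube s)
      ≡⟨ solve 10 (λ A B x O j l p q m s →
           A :* B :* (cubeₚ j :* cubeₚ l) :* (x :* O :* p :- m :* q :* cubeₚ s)
           := B :* p :* cubeₚ l :* (A :* x :* O :* cubeₚ j) :- B :* q :* cubeₚ j :* (m :* A) :* cubeₚ (s :* l))
           refl A (ι 16 * quint n) x (cube (odd m)) j l (π n u) (π n x) m s ⟩
    F - H * cube (s * l)
      ≡⟨ cong (λ t → F - H * cube t) sl≡1 ⟩
    F - H * 1ℚ
      ≡⟨ cong (λ t → F - t) (ℚₚ.*-identityʳ H) ⟩
    F - H ∎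
    where
    open ≡-Reasoning
    x = n + m
    u = x + 1ℚ
    r = odd x
    s = odd u
    y₁ = A * (ι 16 * quint n * (x * cube j))
    y₂ = y₁ * (ι 16 * quint (n + 1ℚ) * (u * cube l))
    F = ι 16 * quint n * π n u * cube l * (A * x * cube (odd m) * cube j)
    H = ι 16 * quint n * π n x * cube j * (m * A)
    E : ℚ → ℚ → ℚ
    E c d = A * (ι 16 * quint n) * (cube j * cube l * (ι 16 * quint (n + 1ℚ) * (x * u))
              - α n * x * (cube j * cube d) + n * (cube c * cube d))

-- The half-integer series and the recurrence of its partial sums.

module DombSeries where
  open import Data.Nat as ℕ using (ℕ; suc)
  import Data.Nat.Properties as ℕₚ
  open import Data.Rational
  import Data.Rational.Properties as ℚₚ
  open import Data.Rational.Solver using (module +-*-Solver)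
  open import Relation.Binary.PropositionalEquality
  open +-*-Solver
  open Naturals
  open Estimates
  open Telescoping

  h : ℕ → ℚ
  h s = inv (2 ℕ.* s)

  odd*h : ∀ s → odd (ι s) * h s ≡ 1ℚ
  odd*h s = trans (cong (_* h s) (sym (trans (ι-suc (2 ℕ.* s)) (cong (_+ 1ℚ) (ι-* 2 s)))))
                  (ι*inv (2 ℕ.* s))

  -- y N m is R_N(m + 1/2); the index N belongs to P_{N-1} and Q_{N-1}.
  y : ℕ → ℕ → ℚ
  y ℕ.zero  m = ι 16 * cube (h m)
  y (suc k) m = y k m * (ι 16 * quint (ι (suc k)) * (ι (suc (k ℕ.+ m)) * cube (h (suc (k ℕ.+ m)))))

  -- The terms are hypergeometric in m as well as in k. Keeping the factor m + 1 on the left avoids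
  -- a division and yields exactly the product that occurs in `G k (suc m)`.
  y-shift : ∀ k m →
    y k (suc m) * ι (suc m) ≡ y k m * ι (suc (k ℕ.+ m)) * cube (odd (ι m)) * cube (h (suc (k ℕ.+ m)))
  y-shift ℕ.zero m = begin
    ι 16 * cube (h (suc m)) * ι (suc m)
      ≡⟨ ℚₚ.*-identityʳ _ ⟨
    ι 16 * cube (h (suc m)) * ι (suc m) * cube 1ℚ
      ≡⟨ cong (λ t → ι 16 * cube (h (suc m)) * ι (suc m) * cube t) (odd*h m) ⟨
    ι 16 * cube (h (suc m)) * ι (suc m) * cube (odd (ι m) * h m)
      ≡⟨ solve 4 (λ h h′ m o → c 16 :* cubeₚ h′ :* m :* cubeₚ (o :* h)
                               := c 16 :* cubeₚ h :* m :* cubeₚ o :* cubeₚ h′)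
           refl (h m) (h (suc m)) (ι (suc m)) (odd (ι m)) ⟩
    ι 16 * cube (h m) * ι (suc m) * cube (odd (ι m)) * cube (h (suc m)) ∎
    where open ≡-Reasoning
  y-shift (suc k) m rewrite ℕₚ.+-suc k m = begin
    y k (suc m) * (B * (X * H)) * ι (suc m)
      ≡⟨ solve 5 (λ Y B X H m → Y :* (B :* (X :* H)) :* m := Y :* m :* (B :* (X :* H)))
           refl (y k (suc m)) B X H (ι (suc m)) ⟩
    y k (suc m) * ι (suc m) * (B * (X * H))
      ≡⟨ cong (_* (B * (X * H))) (y-shift k m) ⟩
    y k m * ι (suc (k ℕ.+ m)) * O * cube (h (suc (k ℕ.+ m))) * (B * (X * H))
      ≡⟨ solve 7 (λ Y x O h B X H → Y :* x :* O :* h :* (B :* (X :* H))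
                                    := Y :* (B :* (x :* h)) :* X :* O :* H)
           refl (y k m) (ι (suc (k ℕ.+ m))) O (cube (h (suc (k ℕ.+ m)))) B X H ⟩
    y k m * (B * (ι (suc (k ℕ.+ m)) * cube (h (suc (k ℕ.+ m))))) * X * O * H ∎
    where
    open ≡-Reasoning
    B = ι 16 * quint (ι (suc k))
    X = ι (suc (suc (k ℕ.+ m)))
    H = cube (h (suc (suc (k ℕ.+ m))))
    O = cube (odd (ι m))

  -- The certificate: a rational multiple of the term itself. Its factor m makes it vanish at m = 0,
  -- so that summation leaves only the upper boundary value.
  G : ℕ → ℕ → ℚ
  G k m = ι 16 * quint n * π n (ι (suc (k ℕ.+ m))) * cube (h (suc (k ℕ.+ m))) * (ι m * y k m)
    where n = ι (suc k)

  y-telescopes : ∀ k m → let n = ι (suc k) in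
    y (2 ℕ.+ k) m - α n * y (suc k) m + ι 16 * (cube n * cube n) * y k m ≡ G k (suc m) - G k m
  y-telescopes k m = begin
    y (2 ℕ.+ k) m - α n * y (suc k) m + ι 16 * (cube n * cube n) * A
      ≡⟨ cong₂ (λ N u → y (suc k) m * (ι 16 * quint N * (u * cube l)) - α n * y (suc k) m
                         + ι 16 * (cube n * cube n) * A)
           (ι-suc (suc k)) (ι-suc (suc (k ℕ.+ m))) ⟩
    Z x
      ≡⟨ cong Z x≡n+m ⟩
    Z (n + ι m)
      ≡⟨ telescoping-algebra A n (ι m) j l
           (trans (cong (λ t → odd t * j) (sym x≡n+m)) (odd*h (suc (k ℕ.+ m))))
           (trans (cong (λ t → odd t * l) (sym (trans x+1 (cong (_+ 1ℚ) x≡n+m)))) (odd*h (2 ℕ.+ (k ℕ.+ m)))) ⟩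
    W (n + ι m)
      ≡⟨ cong W x≡n+m ⟨
    W x
      -- The first summand still speaks of `y k m`; `y-shift` turns it into the certificate at m +
      -- 1.
      ≡⟨ cong₂ (λ u t → ι 16 * quint n * π n u * cube l * t - G k m)
           (sym x+1) (trans (sym (y-shift k m)) (ℚₚ.*-comm (y k (suc m)) (ι (suc m)))) ⟩
    ι 16 * quint n * π n (ι (suc (suc (k ℕ.+ m)))) * cube l * (ι (suc m) * y k (suc m)) - G k m
      ≡⟨ cong (λ t → ι 16 * quint n * π n (ι (suc t)) * cube (h (suc t)) * (ι (suc m) * y k (suc m)) - G k m)
           (sym (ℕₚ.+-suc k m)) ⟩
    G k (suc m) - G k m ∎
    where
    open ≡-Reasoning
    n = ι (suc k)
    x = ι (suc (k ℕ.+ m))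
    A = y k m
    j = h (suc (k ℕ.+ m))
    l = h (suc (suc (k ℕ.+ m)))
    x≡n+m : x ≡ n + ι m
    x≡n+m = ι-+ (suc k) m
    x+1 : ι (suc (suc (k ℕ.+ m))) ≡ x + 1ℚ
    x+1 = ι-suc (suc (k ℕ.+ m))
    Z : ℚ → ℚ
    Z x = A * (ι 16 * quint n * (x * cube j)) * (ι 16 * quint (n + 1ℚ) * ((x + 1ℚ) * cube l))
          - α n * (A * (ι 16 * quint n * (x * cube j))) + ι 16 * (cube n * cube n) * A
    W : ℚ → ℚ
    W x = ι 16 * quint n * π n (x + 1ℚ) * cube l * (A * x * cube (odd (ι m)) * cube j)
          - ι 16 * quint n * π n x * cube j * (ι m * A)

  Y : ℕ → ℕ → ℚ
  Y k = ∑ (y k)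

  Y-recurrence : ∀ k M → let n = ι (suc k) in
    Y (2 ℕ.+ k) M - α n * Y (suc k) M + ι 16 * (cube n * cube n) * Y k M ≡ G k M
  Y-recurrence k ℕ.zero =
    solve 4 (λ a b d e → c 0 :- a :* c 0 :+ b :* c 0 := d :* (c 0 :* e))
      refl (α n) (ι 16 * (cube n * cube n))
      (ι 16 * quint n * π n (ι (suc (k ℕ.+ 0))) * cube (h (suc (k ℕ.+ 0)))) (y k 0)
    where n = ι (suc k)
  Y-recurrence k (suc M) = begin
    (Y (2 ℕ.+ k) M + y (2 ℕ.+ k) M) - a * (Y (suc k) M + y (suc k) M) + b * (Y k M + y k M)
      ≡⟨ solve 8 (λ Y₂ y₂ Y₁ y₁ Y₀ y₀ a b →
           (Y₂ :+ y₂) :- a :* (Y₁ :+ y₁) :+ b :* (Y₀ :+ y₀)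
           := (Y₂ :- a :* Y₁ :+ b :* Y₀) :+ (y₂ :- a :* y₁ :+ b :* y₀))
           refl (Y (2 ℕ.+ k) M) (y (2 ℕ.+ k) M) (Y (suc k) M) (y (suc k) M) (Y k M) (y k M) a b ⟩
    (Y (2 ℕ.+ k) M - a * Y (suc k) M + b * Y k M) + (y (2 ℕ.+ k) M - a * y (suc k) M + b * y k M)
      ≡⟨ cong₂ _+_ (Y-recurrence k M) (y-telescopes k M) ⟩
    G k M + (G k (suc M) - G k M)
      ≡⟨ solve 2 (λ p q → p :+ (q :- p) := q) refl (G k M) (G k (suc M)) ⟩
    G k (suc M) ∎
    where
    open ≡-Reasoning
    a = α (ι (suc k))
    b = ι 16 * (cube (ι (suc k)) * cube (ι (suc k)))

  -- At n = 0 the recurrence degenerates to two terms, since b₀ = 0 and a₀ = 2, and has its own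
  -- certificate. That one lacks the factor m: its value 16 + 8 at m = 0 survives and is the origin
  -- of the constant 24.
  G₀ : ℕ → ℚ
  G₀ m = ι 16 * cube (h m) + ι 8 * (h m * h m)

  -- Powers of `odd m * j` and `odd (m + 1ℚ) * l`, both equal to 1, are inserted until every term
  -- carries j³l³; a polynomial identity in m remains.
  y₀-algebra : ∀ m j l → odd m * j ≡ 1ℚ → odd (m + 1ℚ) * l ≡ 1ℚ →
    ι 16 * cube j * (ι 16 * 1ℚ * ((m + 1ℚ) * cube l)) - ι 2 * (ι 16 * cube j)
    ≡ (ι 16 * cube l + ι 8 * (l * l)) - (ι 16 * cube j + ι 8 * (j * j))
  y₀-algebra m j l rj≡1 sl≡1 = begin
    ι 16 * cube j * (ι 16 * 1ℚ * ((m + 1ℚ) * cube l)) - ι 2 * (ι 16 * cube j)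
      ≡⟨ solve 3 (λ m j l →
           c 16 :* cubeₚ j :* (c 16 :* c 1 :* ((m :+ c 1) :* cubeₚ l)) :- c 2 :* (c 16 :* cubeₚ j)
           := c 256 :* (m :+ c 1) :* (cubeₚ j :* cubeₚ l) :- c 32 :* cubeₚ j :* cubeₚ (c 1)) refl m j l ⟩
    K 1ℚ
      ≡⟨ cong K sl≡1 ⟨
    K (s * l)
      ≡⟨ solve 3 (λ m j l → let r = oddₚ m ; s = oddₚ (m :+ c 1) in
           c 256 :* (m :+ c 1) :* (cubeₚ j :* cubeₚ l) :- c 32 :* cubeₚ j :* cubeₚ (s :* l)
           := (c 16 :* cubeₚ l :* cubeₚ (r :* j) :+ c 8 :* (l :* l) :* (cubeₚ (r :* j) :* (s :* l)))
              :- (c 16 :* cubeₚ j :* cubeₚ (s :* l) :+ c 8 :* (j :* j) :* ((r :* j) :* cubeₚ (s :* l))))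
           refl m j l ⟩
    L (r * j) (s * l)
      ≡⟨ cong₂ L rj≡1 sl≡1 ⟩
    L 1ℚ 1ℚ
      ≡⟨ solve 2 (λ j l →
           (c 16 :* cubeₚ l :* cubeₚ (c 1) :+ c 8 :* (l :* l) :* (cubeₚ (c 1) :* c 1))
           :- (c 16 :* cubeₚ j :* cubeₚ (c 1) :+ c 8 :* (j :* j) :* (c 1 :* cubeₚ (c 1)))
           := (c 16 :* cubeₚ l :+ c 8 :* (l :* l)) :- (c 16 :* cubeₚ j :+ c 8 :* (j :* j))) refl j l ⟩
    (ι 16 * cube l + ι 8 * (l * l)) - (ι 16 * cube j + ι 8 * (j * j)) ∎
    where
    open ≡-Reasoning
    r = odd m
    s = odd (m + 1ℚ)
    K : ℚ → ℚ
    K d = ι 256 * (m + 1ℚ) * (cube j * cube l) - ι 32 * cube j * cube d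
    L : ℚ → ℚ → ℚ
    L c d = (ι 16 * cube l * cube c + ι 8 * (l * l) * (cube c * d))
            - (ι 16 * cube j * cube d + ι 8 * (j * j) * (c * cube d))

  y₀-telescopes : ∀ m → y 1 m - ι 2 * y 0 m ≡ G₀ (suc m) - G₀ m
  y₀-telescopes m =
    trans (cong (λ t → y 0 m * (ι 16 * 1ℚ * (t * cube (h (suc m)))) - ι 2 * y 0 m) (ι-suc m))
      (y₀-algebra (ι m) (h m) (h (suc m)) (odd*h m)
        (trans (cong (λ t → odd t * h (suc m)) (sym (ι-suc m))) (odd*h (suc m))))

  Y₀-recurrence : ∀ M → Y 1 M - ι 2 * Y 0 M ≡ G₀ M - ι 24
  Y₀-recurrence ℕ.zero  = refl
  Y₀-recurrence (suc M) = begin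
    (Y 1 M + y 1 M) - ι 2 * (Y 0 M + y 0 M)
      ≡⟨ solve 4 (λ Y₁ y₁ Y₀ y₀ → (Y₁ :+ y₁) :- c 2 :* (Y₀ :+ y₀)
                                   := (Y₁ :- c 2 :* Y₀) :+ (y₁ :- c 2 :* y₀))
           refl (Y 1 M) (y 1 M) (Y 0 M) (y 0 M) ⟩
    (Y 1 M - ι 2 * Y 0 M) + (y 1 M - ι 2 * y 0 M)
      ≡⟨ cong₂ _+_ (Y₀-recurrence M) (y₀-telescopes M) ⟩
    (G₀ M - ι 24) + (G₀ (suc M) - G₀ M)
      ≡⟨ solve 2 (λ p q → (p :- c 24) :+ (q :- p) := q :- c 24) refl (G₀ M) (G₀ (suc M)) ⟩
    G₀ (suc M) - ι 24 ∎
    where open ≡-Reasoning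

-- Growth of the terms in k, decay of terms and boundary values in m.

module SeriesBounds where
  open import Data.Nat as ℕ using (ℕ; suc)
  import Data.Nat.Properties as ℕₚ
  open import Data.Product using (∃; _×_; _,_)
  open import Data.Rational
  import Data.Rational.Properties as ℚₚ
  open import Data.Rational.Solver using (module +-*-Solver)
  open import Relation.Binary.PropositionalEquality
  open +-*-Solver
  open Naturals
  open Estimates
  open Telescoping
  open DombSeries

  0≤h : ∀ s → 0ℚ ≤ h s
  0≤h s = 0≤inv (2 ℕ.* s)

  0≤cube : ∀ {p} → 0ℚ ≤ p → 0ℚ ≤ cube p
  0≤cube 0≤p = *-nonNeg (*-nonNeg 0≤p 0≤p) 0≤p

  ι-mono : ∀ {m n} → m ℕ.≤ n → ι m ≤ ι n
  ι-mono {m} {n} m≤n = subst (ι m ≤_)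
    (trans (sym (ι-+ m (n ℕ.∸ m))) (cong ι (ℕₚ.m+[n∸m]≡n m≤n))) (p≤p+q (0≤ι (n ℕ.∸ m)))

  2ιh≤1 : ∀ {r s} → r ℕ.≤ s → ι 2 * ι r * h s ≤ 1ℚ
  2ιh≤1 {r} {s} r≤s = begin
    ι 2 * ι r * h s            ≤⟨ ℚₚ.*-monoʳ-≤-nonNeg (h s) {{nonNegative (0≤h s)}}
                                    (ℚₚ.*-monoˡ-≤-nonNeg (ι 2) (ι-mono r≤s)) ⟩
    ι 2 * ι s * h s            ≤⟨ p≤p+q (0≤h s) ⟩
    ι 2 * ι s * h s + h s      ≡⟨ solve 2 (λ s h → c 2 :* s :* h :+ h := oddₚ s :* h) refl (ι s) (h s) ⟩
    odd (ι s) * h s            ≡⟨ odd*h s ⟩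
    1ℚ                         ∎
    where open ℚₚ.≤-Reasoning

  0≤2ιh : ∀ r s → 0ℚ ≤ ι 2 * ι r * h s
  0≤2ιh r s = *-nonNeg (*-nonNeg (0≤ι 2) (0≤ι r)) (0≤h s)

  ιh≤1 : ∀ {r s} → r ℕ.≤ s → ι r * h s ≤ 1ℚ
  ιh≤1 {r} {s} r≤s = ℚₚ.≤-trans (p≤p+q 0≤rh)
    (subst (_≤ 1ℚ) (solve 2 (λ r h → c 2 :* r :* h := r :* h :+ r :* h) refl (ι r) (h s)) (2ιh≤1 r≤s))
    where
    0≤rh : 0ℚ ≤ ι r * h s
    0≤rh = *-nonNeg (0≤ι r) (0≤h s)

  h≤inv : ∀ s → h s ≤ inv s
  h≤inv s = inv-anti (ℕₚ.m≤m+n s (s ℕ.+ 0))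

  h≤1 : ∀ s → h s ≤ 1ℚ
  h≤1 s = inv-anti {0} {2 ℕ.* s} ℕ.z≤n

  0≤y : ∀ k m → 0ℚ ≤ y k m
  0≤y ℕ.zero  m = *-nonNeg (0≤ι 16) (0≤cube (0≤h m))
  0≤y (suc k) m = *-nonNeg (0≤y k m) (*-nonNeg
    (*-nonNeg (0≤ι 16) (*-nonNeg (0≤cube (0≤ι (suc k))) (*-nonNeg (0≤ι (suc k)) (0≤ι (suc k)))))
    (*-nonNeg (0≤ι (suc (k ℕ.+ m))) (0≤cube (0≤h (suc (k ℕ.+ m))))))

  -- With x = n + m the ratio is 2n³ · (2n/(2x+1))² · (2x/(2x+1)), and the last factors are at most
  -- 1 because n ≤ x. This is the root 2, uniformly in m.
  y-ratio : ∀ k m → y (suc k) m ≤ ι 2 * cube (ι (suc k)) * y k m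
  y-ratio k m = begin
    y k m * (ι 16 * quint n * (ι s * cube (h s)))
      ≡⟨ solve 4 (λ y n x h → y :* (c 16 :* quintₚ n :* (x :* cubeₚ h))
           := ((c 2 :* n :* h) :* (c 2 :* n :* h) :* (c 2 :* x :* h)) :* (c 2 :* cubeₚ n :* y))
           refl (y k m) n (ι s) (h s) ⟩
    (ι 2 * n * h s) * (ι 2 * n * h s) * (ι 2 * ι s * h s) * (ι 2 * cube n * y k m)
      ≤⟨ *-shrink (*-nonNeg (*-nonNeg (0≤ι 2) (0≤cube (0≤ι (suc k)))) (0≤y k m))
           (*-≤1 (0≤2ιh s s) (*-≤1 (0≤2ιh (suc k) s) (2ιh≤1 k≤s) (2ιh≤1 k≤s)) (2ιh≤1 {s} ℕₚ.≤-refl)) ⟩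
    ι 2 * cube n * y k m ∎
    where
    open ℚₚ.≤-Reasoning
    n = ι (suc k)
    s = suc (k ℕ.+ m)
    k≤s : suc k ℕ.≤ s
    k≤s = ℕₚ.m≤m+n (suc k) m

  0≤Y : ∀ k M → 0ℚ ≤ Y k M
  0≤Y k = ∑-nonNeg (0≤y k)

  Y-ratio : ∀ k M → Y (suc k) M ≤ ι 2 * cube (ι (suc k)) * Y k M
  Y-ratio k = ∑-mono (ι 2 * cube (ι (suc k))) (y-ratio k)

  y-bound : ∀ k → ∃ λ C → 0ℚ ≤ C × ∀ m → y k m ≤ C * cube (h m)
  y-bound ℕ.zero  = ι 16 , 0≤ι 16 , λ _ → ℚₚ.≤-refl
  y-bound (suc k) =
    let C , 0≤C , y≤ = y-bound k
        D   = ι 2 * cube (ι (suc k))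
        0≤D = *-nonNeg (0≤ι 2) (0≤cube (0≤ι (suc k)))
    in  D * C , *-nonNeg 0≤D 0≤C , λ m → subst (y (suc k) m ≤_) (sym (ℚₚ.*-assoc D C (cube (h m))))
          (ℚₚ.≤-trans (y-ratio k m) (ℚₚ.*-monoˡ-≤-nonNeg D {{nonNegative 0≤D}} (y≤ m)))

  hh≤inv : ∀ m → h m * h m ≤ inv m
  hh≤inv m = ℚₚ.≤-trans (*-shrink (0≤h m) (h≤1 m)) (h≤inv m)

  ιy-O : ∀ k → O[1/n] (λ m → ι m * y k m)
  ιy-O k = let C , 0≤C , y≤ = y-bound k in C , λ m →
    ∣nonNeg∣ (*-nonNeg (0≤ι m) (0≤y k m)) (begin
      ι m * y k m
        ≤⟨ ℚₚ.*-monoˡ-≤-nonNeg (ι m) {{nonNegative (0≤ι m)}} (y≤ m) ⟩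
      ι m * (C * cube (h m))
        ≡⟨ solve 3 (λ m C h → m :* (C :* cubeₚ h) := C :* ((m :* h) :* (h :* h))) refl (ι m) C (h m) ⟩
      C * ((ι m * h m) * (h m * h m))
        ≤⟨ ℚₚ.*-monoˡ-≤-nonNeg C {{nonNegative 0≤C}}
             (ℚₚ.≤-trans (*-shrink (*-nonNeg (0≤h m) (0≤h m)) (ιh≤1 {m} ℕₚ.≤-refl)) (hh≤inv m)) ⟩
      C * inv m ∎)
    where open ℚₚ.≤-Reasoning

  -- `π` has degree 3 in x, so the three factors h can be distributed to turn each power of x into a
  -- power of x · h times a power of h, both at most 1.
  πh³-bounded : ∀ n (s : ℕ → ℕ) → Bounded (λ m → π n (ι (s m)) * cube (h (s m)))
  πh³-bounded n s =
    let B , k = bounded-+ (bounded-+ (bounded-+ (h³ bh bh bh) (bounded-neg (bounded-* (bounded-const c₁) (h³ bx bh bh))))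
                  (bounded-neg (bounded-* (bounded-const c₂) (h³ bx bx bh))))
                  (bounded-neg (bounded-* (bounded-const (ι 4)) (h³ bx bx bx)))
    in  B , λ m → subst (λ p → ∣ p ∣ ≤ B)
          (solve 5 (λ x h a b d →
             h :* h :* h :+ :- (a :* ((x :* h) :* h :* h)) :+ :- (b :* ((x :* h) :* (x :* h) :* h))
               :+ :- (d :* ((x :* h) :* (x :* h) :* (x :* h)))
             := (c 1 :- a :* x :- b :* (x :* x) :- d :* cubeₚ x) :* cubeₚ h)
             refl (ι (s m)) (h (s m)) c₁ c₂ (ι 4))
          (k m)
    where
    c₁ = ι 2 * (n * n) + ι 7 * n + ι 2
    c₂ = ι 6 * (n + 1ℚ)
    bh : Bounded (λ m → h (s m))
    bh = 1ℚ , λ m → ∣nonNeg∣ (0≤h (s m)) (h≤1 (s m))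
    bx : Bounded (λ m → ι (s m) * h (s m))
    bx = 1ℚ , λ m → ∣nonNeg∣ (*-nonNeg (0≤ι (s m)) (0≤h (s m))) (ιh≤1 {s m} ℕₚ.≤-refl)
    h³ : ∀ {f g k} → Bounded f → Bounded g → Bounded k → Bounded (λ m → f m * g m * k m)
    h³ bf bg = bounded-* (bounded-* bf bg)

  G-O : ∀ k → O[1/n] (G k)
  G-O k = O-cong
    (λ m → cong (_* (ι m * y k m)) (sym (ℚₚ.*-assoc (ι 16 * quint n) (π n (ι (s m))) (cube (h (s m))))))
    (O-* (bounded-* (bounded-const (ι 16 * quint n)) (πh³-bounded n s)) (ιy-O k))
    where
    n = ι (suc k)
    s : ℕ → ℕ
    s m = suc (k ℕ.+ m)

  G₀-O : O[1/n] G₀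
  G₀-O = O-+ (O-scale (ι 16) (1ℚ , λ m → ∣nonNeg∣ (0≤cube (0≤h m)) (begin
               h m * h m * h m       ≤⟨ *-shrink (0≤h m) (*-≤1 (0≤h m) (h≤1 m) (h≤1 m)) ⟩
               h m                   ≤⟨ h≤inv m ⟩
               inv m                 ≡⟨ ℚₚ.*-identityˡ (inv m) ⟨
               1ℚ * inv m            ∎)))
             (O-scale (ι 8) (1ℚ , λ m → ∣nonNeg∣ (*-nonNeg (0≤h m) (0≤h m))
               (subst (h m * h m ≤_) (sym (ℚₚ.*-identityˡ (inv m))) (hh≤inv m))))
    where open ℚₚ.≤-Reasoning

-- The sum over odd denominators in terms of ζ(3).

module OddZeta where
  open import Data.Nat as ℕ using (ℕ; suc)
  import Data.Nat.Properties as ℕₚ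
  open import Data.Integer using (+_)
  open import Data.Product using (_,_)
  open import Data.Rational
  import Data.Rational.Properties as ℚₚ
  open import Data.Rational.Solver using (module +-*-Solver)
  open import Relation.Binary.PropositionalEquality
  open +-*-Solver
  open ZetaLemmas
  open Naturals
  open Estimates
  open Telescoping
  open DombSeries

  inverse-unique : ∀ p q r → p * q ≡ 1ℚ → p * r ≡ 1ℚ → q ≡ r
  inverse-unique p q r pq≡1 pr≡1 = begin
    q            ≡⟨ ℚₚ.*-identityʳ q ⟨
    q * 1ℚ       ≡⟨ cong (q *_) pr≡1 ⟨
    q * (p * r)  ≡⟨ solve 3 (λ p q r → q :* (p :* r) := (p :* q) :* r) refl p q r ⟩
    (p * q) * r  ≡⟨ cong (_* r) pq≡1 ⟩
    1ℚ * r       ≡⟨ ℚₚ.*-identityˡ r ⟩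
    r            ∎
    where open ≡-Reasoning

  ι*1/ : ∀ k .{{_ : ℕ.NonZero k}} → ι k * (+ 1 / k) ≡ 1ℚ
  ι*1/ (suc k) = ι*inv k

  ι-cube : ∀ n → ι (n ℕ.^ 3) ≡ cube (ι n)
  ι-cube n = begin
    ι (n ℕ.* (n ℕ.* (n ℕ.* 1)))  ≡⟨ ι-* n (n ℕ.* (n ℕ.* 1)) ⟩
    ι n * ι (n ℕ.* (n ℕ.* 1))    ≡⟨ cong (ι n *_) (ι-* n (n ℕ.* 1)) ⟩
    ι n * (ι n * ι (n ℕ.* 1))    ≡⟨ cong (λ k → ι n * (ι n * ι k)) (ℕₚ.*-identityʳ n) ⟩
    ι n * (ι n * ι n)            ≡⟨ ℚₚ.*-assoc (ι n) (ι n) (ι n) ⟨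
    cube (ι n)                   ∎
    where open ≡-Reasoning

  S : ℕ → ℚ
  S = zetaSum 3

  S-suc : ∀ n → S (suc n) ≡ S n + cube (inv n)
  S-suc n = cong (λ t → S n + t) (inverse-unique (ι (suc n ℕ.^ 3)) _ (cube (inv n))
    (ι*1/ (suc n ℕ.^ 3) {{ℕₚ.m^n≢0 (suc n) 3}})
    (begin
      ι (suc n ℕ.^ 3) * cube (inv n)   ≡⟨ cong (_* cube (inv n)) (ι-cube (suc n)) ⟩
      cube (ι (suc n)) * cube (inv n)  ≡⟨ solve 2 (λ p q → cubeₚ p :* cubeₚ q := cubeₚ (p :* q)) refl (ι (suc n)) (inv n) ⟩
      cube (ι (suc n) * inv n)         ≡⟨ cong cube (ι*inv n) ⟩
      1ℚ                               ∎))
    where open ≡-Reasoning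

  inv-double : ∀ n → ι 2 * inv (suc (2 ℕ.* n)) ≡ inv n
  inv-double n = inverse-unique (ι (suc n)) _ (inv n) (begin
    ι (suc n) * (ι 2 * i)      ≡⟨ solve 3 (λ a b c → a :* (b :* c) := (b :* a) :* c) refl (ι (suc n)) (ι 2) i ⟩
    ι 2 * ι (suc n) * i        ≡⟨ cong (_* i) (ι-* 2 (suc n)) ⟨
    ι (2 ℕ.* suc n) * i        ≡⟨ cong (λ k → ι k * i) (ℕₚ.*-suc 2 n) ⟩
    ι (2 ℕ.+ 2 ℕ.* n) * i      ≡⟨ ι*inv (suc (2 ℕ.* n)) ⟩
    1ℚ                         ∎)
    (ι*inv n)
    where
    open ≡-Reasoning
    i = inv (suc (2 ℕ.* n))

  -- The odd terms up to 2M are all terms minus the even ones, and the even ones add up to S(M)/8.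
  -- In the limit 16 - 2 gives the factor 14.
  Y₀≡16S₂-2S : ∀ M → Y 0 M ≡ ι 16 * S (2 ℕ.* M) - ι 2 * S M
  Y₀≡16S₂-2S ℕ.zero  = refl
  Y₀≡16S₂-2S (suc M) = begin
    Y 0 M + ι 16 * cube (h M)
      ≡⟨ cong (_+ ι 16 * cube (h M)) (Y₀≡16S₂-2S M) ⟩
    (ι 16 * S (2 ℕ.* M) - ι 2 * S M) + ι 16 * cube (h M)
      ≡⟨ solve 4 (λ s s₂ h i → (c 16 :* s₂ :- c 2 :* s) :+ c 16 :* cubeₚ h
           := c 16 :* ((s₂ :+ cubeₚ h) :+ cubeₚ i) :- c 2 :* (s :+ cubeₚ (c 2 :* i)))
           refl (S M) (S (2 ℕ.* M)) (h M) i ⟩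
    ι 16 * ((S (2 ℕ.* M) + cube (h M)) + cube i) - ι 2 * (S M + cube (ι 2 * i))
      ≡⟨ cong₂ (λ p q → ι 16 * p - ι 2 * q) S₂ (cong (λ t → S M + cube t) (inv-double M)) ⟩
    ι 16 * S (2 ℕ.* suc M) - ι 2 * (S M + cube (inv M))
      ≡⟨ cong (λ t → ι 16 * S (2 ℕ.* suc M) - ι 2 * t) (S-suc M) ⟨
    ι 16 * S (2 ℕ.* suc M) - ι 2 * S (suc M) ∎
    where
    open ≡-Reasoning
    i = inv (suc (2 ℕ.* M))
    S₂ : (S (2 ℕ.* M) + cube (h M)) + cube i ≡ S (2 ℕ.* suc M)
    S₂ = begin
      (S (2 ℕ.* M) + cube (h M)) + cube i  ≡⟨ cong (_+ cube i) (S-suc (2 ℕ.* M)) ⟨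
      S (suc (2 ℕ.* M)) + cube i           ≡⟨ S-suc (suc (2 ℕ.* M)) ⟨
      S (2 ℕ.+ 2 ℕ.* M)                    ≡⟨ cong S (ℕₚ.*-suc 2 M) ⟨
      S (2 ℕ.* suc M)                      ∎

  inv≤2inv-suc : ∀ n → inv n ≤ ι 2 * inv (suc n)
  inv≤2inv-suc n = subst (_≤ ι 2 * inv (suc n)) (inv-double n)
    (ℚₚ.*-monoˡ-≤-nonNeg (ι 2) (inv-anti (ℕ.s≤s (ℕₚ.m≤m+n n (n ℕ.+ 0)))))

  S₂-S-O : O[1/n] (λ M → S (2 ℕ.* M) - S M)
  -- The tail after M ≥ 1 terms is at most 1/M, while the rate is 1/(M + 1); the factor 2 absorbs
  -- the shift.
  S₂-S-O = ι 2 , λ where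
    ℕ.zero    → *-nonNeg (0≤ι 2) (0≤inv 0)
    (suc k)   → ℚₚ.≤-trans (zetaSum-tail 3 (ℕ.s≤s (ℕ.s≤s ℕ.z≤n)) k k (k ℕ.+ suc (k ℕ.+ 0)) ℕₚ.≤-refl (ℕₚ.m≤m+n k _))
                  (inv≤2inv-suc k)

  Y₀-14S-O : O[1/n] (λ M → Y 0 M - ι 14 * S M)
  Y₀-14S-O = O-cong
    (λ M → trans (solve 2 (λ p q → c 16 :* (p :- q) := (c 16 :* p :- c 2 :* q) :- c 14 :* q) refl (S (2 ℕ.* M)) (S M))
                 (cong (_- ι 14 * S M) (sym (Y₀≡16S₂-2S M))))
    (O-scale (ι 16) S₂-S-O)

  0≤S : ∀ n → 0ℚ ≤ S n
  0≤S n = zetaSum-mono 3 (ℕₚ.≤⇒≤′ (ℕ.z≤n {n}))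

  1≤S : ∀ {n} → 1 ℕ.≤ n → 1ℚ ≤ S n
  1≤S 1≤n = zetaSum-mono 3 (ℕₚ.≤⇒≤′ 1≤n)

  -- The decreasing quantity S(n) + 1/n has the value 2 at n = 1.
  S≤2 : ∀ n → S n ≤ ι 2
  S≤2 ℕ.zero  = 0≤ι 2
  S≤2 (suc n) = ℚₚ.≤-trans (p≤p+q (0≤inv n))
    (zetaSum+1/n-anti 3 (ℕ.s≤s (ℕ.s≤s ℕ.z≤n)) (ℕₚ.≤⇒≤′ (ℕ.z≤n {n})))

  Y₀≤32 : ∀ M → Y 0 M ≤ ι 32
  Y₀≤32 M = begin
    Y 0 M                                       ≤⟨ p≤p+q (*-nonNeg (0≤ι 2) (0≤S M)) ⟩
    Y 0 M + ι 2 * S M                           ≡⟨ cong (_+ ι 2 * S M) (Y₀≡16S₂-2S M) ⟩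
    ι 16 * S (2 ℕ.* M) - ι 2 * S M + ι 2 * S M  ≡⟨ solve 2 (λ p q → p :- q :+ q := p) refl (ι 16 * S (2 ℕ.* M)) (ι 2 * S M) ⟩
    ι 16 * S (2 ℕ.* M)                          ≤⟨ ℚₚ.*-monoˡ-≤-nonNeg (ι 16) (S≤2 (2 ℕ.* M)) ⟩
    ι 32                                        ∎
    where open ℚₚ.≤-Reasoning


-- Lower bounds for growing solutions of the recurrence.

module Growth where
  open import Data.Nat as ℕ using (ℕ; suc)
  open import Data.Integer using (+_)
  open import Data.Product using (_×_; _,_; proj₁; proj₂)
  open import Data.Rational
  import Data.Rational.Properties as ℚₚ
  open import Data.Rational.Solver using (module +-*-Solver)
  open import Relation.Binary.PropositionalEquality
  open +-*-Solver
  open RationalLemmas using (*-pos)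
  open Naturals
  open Estimates
  open Telescoping
  open SeriesBounds using (0≤cube)

  Satisfies : (ℕ → ℚ) → Set
  Satisfies f = ∀ k → let t = ι (2 ℕ.+ k) in
    f (2 ℕ.+ k) ≡ α t * f (suc k) - ι 16 * (cube t * cube t) * f k

  -- The cube is taken at k + 2 because index k corresponds to N = k + 1, where solutions scale like
  -- N!³.
  Grows : (ℕ → ℚ) → ℕ → Set
  Grows f k = 0ℚ ≤ f k × ι 3 * cube (ι (2 ℕ.+ k)) * f k ≤ f (suc k)

  -- The inductive bound F₁ ≥ 3t³F₀ replaces the subtracted term by (16/3)t³F₁. What remains of the
  -- coefficient of F₁ beyond 3(t + 1)³ has only positive coefficients in w = t - 1, the leading one
  -- being 10 - 16/3 - 3 = 5/3.
  growth-algebra : ∀ w F₀ F₁ → let t = w + 1ℚ in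
    α t * F₁ - ι 16 * (cube t * cube t) * F₀
    ≡ ι 3 * cube (t + 1ℚ) * F₁
      + ((+ 16 / 3) * cube t * (F₁ - ι 3 * cube t * F₀)
         + ((+ 5 / 3) * cube w + ι 11 * (w * w) + ι 17 * w + (+ 20 / 3)) * F₁)
  growth-algebra = solve 3 (λ w F₀ F₁ → let t = w :+ c 1 in
    αₚ t :* F₁ :- c 16 :* (cubeₚ t :* cubeₚ t) :* F₀
    := c 3 :* cubeₚ (t :+ c 1) :* F₁
       :+ (con (+ 16 / 3) :* cubeₚ t :* (F₁ :- c 3 :* cubeₚ t :* F₀)
          :+ (con (+ 5 / 3) :* cubeₚ w :+ c 11 :* (w :* w) :+ c 17 :* w :+ con (+ 20 / 3)) :* F₁)) refl

  grows-step : ∀ {f} → Satisfies f → ∀ k → Grows f k → Grows f (suc k)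
  grows-step {f} sat k (0≤F₀ , 3t³F₀≤F₁) = 0≤F₁ , (begin
    ι 3 * cube (ι (3 ℕ.+ k)) * F₁
      ≡⟨ cong (λ t → ι 3 * cube t * F₁) (trans (ι-suc (2 ℕ.+ k)) (cong (_+ 1ℚ) (ι-suc (suc k)))) ⟩
    ι 3 * cube (w + 1ℚ + 1ℚ) * F₁
      ≤⟨ p≤p+q (+-nonNeg
           (*-nonNeg (*-nonNeg (ℚₚ.nonNegative⁻¹ (+ 16 / 3)) (0≤cube (subst (0ℚ ≤_) (ι-suc (suc k)) (0≤ι (2 ℕ.+ k)))))
                     (0≤q-p (subst (λ t → ι 3 * cube t * F₀ ≤ F₁) (ι-suc (suc k)) 3t³F₀≤F₁)))
           (*-nonNeg (+-nonNeg (+-nonNeg (+-nonNeg (*-nonNeg (ℚₚ.nonNegative⁻¹ (+ 5 / 3)) (0≤cube 0≤w))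
                                                   (*-nonNeg (0≤ι 11) (*-nonNeg 0≤w 0≤w)))
                                         (*-nonNeg (0≤ι 17) 0≤w))
                               (ℚₚ.nonNegative⁻¹ (+ 20 / 3)))
                     0≤F₁)) ⟩
    ι 3 * cube (w + 1ℚ + 1ℚ) * F₁
      + ((+ 16 / 3) * cube (w + 1ℚ) * (F₁ - ι 3 * cube (w + 1ℚ) * F₀)
         + ((+ 5 / 3) * cube w + ι 11 * (w * w) + ι 17 * w + (+ 20 / 3)) * F₁)
      ≡⟨ growth-algebra w F₀ F₁ ⟨
    α (w + 1ℚ) * F₁ - ι 16 * (cube (w + 1ℚ) * cube (w + 1ℚ)) * F₀
      ≡⟨ cong (λ t → α t * F₁ - ι 16 * (cube t * cube t) * F₀) (ι-suc (suc k)) ⟨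
    α (ι (2 ℕ.+ k)) * F₁ - ι 16 * (cube (ι (2 ℕ.+ k)) * cube (ι (2 ℕ.+ k))) * F₀
      ≡⟨ sat k ⟨
    f (2 ℕ.+ k) ∎)
    where
    open ℚₚ.≤-Reasoning
    w F₀ F₁ : ℚ
    w = ι (suc k)
    F₀ = f k
    F₁ = f (suc k)
    0≤w : 0ℚ ≤ w
    0≤w = 0≤ι (suc k)
    0≤F₁ : 0ℚ ≤ F₁
    0≤F₁ = ℚₚ.≤-trans (*-nonNeg (*-nonNeg (0≤ι 3) (0≤cube (0≤ι (2 ℕ.+ k)))) 0≤F₀) 3t³F₀≤F₁

  grows : ∀ {f} → Satisfies f → Grows f 0 → ∀ k → Grows f k
  grows sat g₀ ℕ.zero  = g₀
  grows sat g₀ (suc k) = grows-step sat k (grows sat g₀ k)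

  grows⇒pos : ∀ {f} → (∀ k → Grows f k) → 0ℚ < f 0 → ∀ k → 0ℚ < f k
  grows⇒pos g 0<f₀ ℕ.zero  = 0<f₀
  grows⇒pos g 0<f₀ (suc k) = ℚₚ.<-≤-trans (*-pos (*-pos (ℚₚ.positive⁻¹ (ι 3)) 0<t³) (grows⇒pos g 0<f₀ k)) (proj₂ (g k))
    where
    0<t : 0ℚ < ι (2 ℕ.+ k)
    0<t = ℚₚ.positive⁻¹ (ι (2 ℕ.+ k)) {{ℚₚ.normalize-pos (2 ℕ.+ k) 1}}
    0<t³ : 0ℚ < cube (ι (2 ℕ.+ k))
    0<t³ = *-pos (*-pos 0<t 0<t) 0<t

-- Numerators, denominators and the linear form in ζ(3).

module Convergents where
  open import Data.Nat as ℕ using (ℕ; suc)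
  import Data.Nat.Properties as ℕₚ
  open import Data.Integer using (+_)
  open import Data.Product using (_,_; proj₁; proj₂)
  open import Data.Rational
  import Data.Rational.Properties as ℚₚ
  open import Data.Rational.Solver using (module +-*-Solver)
  open import Relation.Binary.PropositionalEquality
  open +-*-Solver
  open Naturals
  open Estimates
  open Telescoping
  open DombSeries
  open SeriesBounds
  open OddZeta
  open Growth

  a b : ℕ → ℚ
  a n = + ((2 ℕ.* n ℕ.+ 1) ℕ.* (5 ℕ.* n ℕ.^ 2 ℕ.+ 5 ℕ.* n ℕ.+ 2)) / 1
  b n = - (+ (16 ℕ.* n ℕ.^ 6) / 1)

  a≡α : ∀ n → a n ≡ α (ι n)
  a≡α n = begin
    ι ((2 ℕ.* n ℕ.+ 1) ℕ.* (5 ℕ.* n ℕ.^ 2 ℕ.+ 5 ℕ.* n ℕ.+ 2))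
      ≡⟨ ι-* (2 ℕ.* n ℕ.+ 1) (5 ℕ.* n ℕ.^ 2 ℕ.+ 5 ℕ.* n ℕ.+ 2) ⟩
    ι (2 ℕ.* n ℕ.+ 1) * ι (5 ℕ.* n ℕ.^ 2 ℕ.+ 5 ℕ.* n ℕ.+ 2)
      ≡⟨ cong₂ _*_ (trans (ι-+ (2 ℕ.* n) 1) (cong (_+ 1ℚ) (ι-* 2 n)))
                   (trans (ι-+ (5 ℕ.* n ℕ.^ 2 ℕ.+ 5 ℕ.* n) 2) (cong (_+ ι 2)
                     (trans (ι-+ (5 ℕ.* n ℕ.^ 2) (5 ℕ.* n)) (cong₂ _+_ ι-5n² (ι-* 5 n))))) ⟩
    α (ι n) ∎
    where
    open ≡-Reasoning
    ι-5n² : ι (5 ℕ.* n ℕ.^ 2) ≡ ι 5 * (ι n * ι n)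
    ι-5n² = trans (ι-* 5 (n ℕ.^ 2)) (cong (ι 5 *_)
      (trans (ι-* n (n ℕ.* 1)) (cong (λ k → ι n * ι k) (ℕₚ.*-identityʳ n))))

  b≡ : ∀ n → b n ≡ - (ι 16 * (cube (ι n) * cube (ι n)))
  b≡ n = cong -_ (trans (ι-* 16 (n ℕ.^ 6)) (cong (ι 16 *_) (begin
    ι (n ℕ.^ 6)                ≡⟨ cong ι (ℕₚ.^-distribˡ-+-* n 3 3) ⟩
    ι (n ℕ.^ 3 ℕ.* n ℕ.^ 3)    ≡⟨ ι-* (n ℕ.^ 3) (n ℕ.^ 3) ⟩
    ι (n ℕ.^ 3) * ι (n ℕ.^ 3)  ≡⟨ cong₂ _*_ (ι-cube n) (ι-cube n) ⟩
    cube (ι n) * cube (ι n)    ∎)))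
    where open ≡-Reasoning

  recurrence-satisfies : ∀ u₋₁ u₀ → Satisfies (recurrence a b u₋₁ u₀)
  recurrence-satisfies u₋₁ u₀ k = trans
    (cong₂ (λ p q → p * U (suc k) + q * U k) (a≡α (2 ℕ.+ k)) (b≡ (2 ℕ.+ k)))
    (solve 4 (λ p q u v → p :* u :+ (:- q) :* v := p :* u :- q :* v) refl
      (α t) (ι 16 * (cube t * cube t)) (U (suc k)) (U k))
    where
    U = recurrence a b u₋₁ u₀
    t = ι (2 ℕ.+ k)

  p q : ℕ → ℚ
  p = P a b
  q = Q a b

  p-grows : ∀ k → Grows p k
  -- P₀ = 2 and P₁ = 56, against 3 · 2³ · 2 = 48.
  p-grows = grows {p} (recurrence-satisfies 1ℚ (a 0)) (0≤ι 2 , ι-mono {48} {56} (ℕₚ.m≤m+n 48 8))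

  0<p : ∀ k → 0ℚ < p k
  0<p = grows⇒pos {p} p-grows (ℚₚ.positive⁻¹ (ι 2))

  -- 2Q - P solves the same recurrence with initial values 0 and 16. Its nonnegativity bounds Q
  -- below by P/2, which also shows that the convergents are defined.
  2q-p-grows : ∀ k → Grows (λ k → ι 2 * q k - p k) k
  2q-p-grows = grows {λ k → ι 2 * q k - p k} sat (ℚₚ.≤-refl , 0≤ι 16)
    where
    sat : Satisfies (λ k → ι 2 * q k - p k)
    sat k = trans
      (cong₂ (λ u v → ι 2 * u - v) (recurrence-satisfies 0ℚ 1ℚ k) (recurrence-satisfies 1ℚ (a 0) k))
      (solve 6 (λ A B q₁ q₀ p₁ p₀ →
        c 2 :* (A :* q₁ :- B :* q₀) :- (A :* p₁ :- B :* p₀)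
        := A :* (c 2 :* q₁ :- p₁) :- B :* (c 2 :* q₀ :- p₀)) refl
        (α t) (ι 16 * (cube t * cube t)) (q (suc k)) (q k) (p (suc k)) (p k))
      where t = ι (2 ℕ.+ k)

  p≤2q : ∀ k → p k ≤ ι 2 * q k
  p≤2q k = subst₂ _≤_ (ℚₚ.+-identityʳ (p k))
    (solve 2 (λ p q → p :+ (c 2 :* q :- p) := c 2 :* q) refl (p k) (q k))
    (ℚₚ.+-monoʳ-≤ (p k) (proj₁ (2q-p-grows k)))

  Y-form : ℕ → ℕ → ℚ
  Y-form k M = Y (suc k) M - Y 0 M * p k + ι 24 * q k

  -- Having `Y 0 M` as coefficient, rather than its limit, makes `Y-form` satisfy the recurrence
  -- exactly, with `G` as inhomogeneous term. So the error stays O(1/M) from one k to the next, the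
  -- constant changing with k.
  Y-form-O : ∀ k → O[1/n] (Y-form k)
  Y-form-O ℕ.zero = O-cong
    (λ M → trans (cong (_+ ι 24) (sym (Y₀-recurrence M)))
                 (solve 2 (λ Y₁ Y₀ → Y₁ :- c 2 :* Y₀ :+ c 24 := Y₁ :- Y₀ :* c 2 :+ c 24 :* c 1) refl (Y 1 M) (Y 0 M)))
    (O-cong (λ M → solve 1 (λ g → g := g :- c 24 :+ c 24) refl (G₀ M)) G₀-O)
  -- The recurrence at n = 1 reaches back to P₋₁ and Q₋₁, which `p` and `q` do not list; the values
  -- P₁ = 56 and Q₁ = 36 are inserted instead.
  Y-form-O (suc ℕ.zero) = O-cong
    (λ M → trans (cong (_+ ι 36 * Y-form 0 M) (sym (Y-recurrence 0 M)))
      (solve 3 (λ Y₂ Y₁ Y₀ →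
        (Y₂ :- c 36 :* Y₁ :+ c 16 :* Y₀) :+ c 36 :* (Y₁ :- Y₀ :* c 2 :+ c 24 :* c 1)
        := Y₂ :- Y₀ :* c 56 :+ c 24 :* c 36) refl (Y 2 M) (Y 1 M) (Y 0 M)))
    (O-+ (G-O 0) (O-scale (ι 36) (Y-form-O 0)))
  Y-form-O (suc (suc k)) = O-cong
    (λ M → trans (cong (λ g → g + A * Y-form (suc k) M + - B * Y-form k M) (sym (Y-recurrence (suc k) M)))
      (trans (solve 10 (λ A B Y₃ Y₂ Y₁ Y₀ p₁ p₀ q₁ q₀ →
               (Y₃ :- A :* Y₂ :+ B :* Y₁) :+ A :* (Y₂ :- Y₀ :* p₁ :+ c 24 :* q₁) :+ (:- B) :* (Y₁ :- Y₀ :* p₀ :+ c 24 :* q₀)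
               := Y₃ :- Y₀ :* (A :* p₁ :- B :* p₀) :+ c 24 :* (A :* q₁ :- B :* q₀)) refl
               A B (Y (3 ℕ.+ k) M) (Y (2 ℕ.+ k) M) (Y (suc k) M) (Y 0 M) (p (suc k)) (p k) (q (suc k)) (q k))
             (cong₂ (λ u v → Y (3 ℕ.+ k) M - Y 0 M * u + ι 24 * v)
               (sym (recurrence-satisfies 1ℚ (a 0) k)) (sym (recurrence-satisfies 0ℚ 1ℚ k)))))
    (O-+ (O-+ (G-O (suc k)) (O-scale A (Y-form-O (suc k)))) (O-scale (- B) (Y-form-O k)))
    where
    A B : ℚ
    A = α (ι (2 ℕ.+ k))
    B = ι 16 * (cube (ι (2 ℕ.+ k)) * cube (ι (2 ℕ.+ k)))

  -- Per step the series gains at most the factor 2(k + 2)³ and P at least 3(k + 2)³. The geometric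
  -- decay (2/3)ᵏ is weakened to 64/(k + 2), for which 2(k + 3) ≤ 3(k + 2) suffices.
  Y-decay : ∀ k M → ι (2 ℕ.+ k) * Y (suc k) M ≤ ι 64 * p k
  Y-decay ℕ.zero M = begin
    ι 2 * Y 1 M            ≤⟨ ℚₚ.*-monoˡ-≤-nonNeg (ι 2) (Y-ratio 0 M) ⟩
    ι 2 * (ι 2 * Y 0 M)    ≤⟨ ℚₚ.*-monoˡ-≤-nonNeg (ι 2) (ℚₚ.*-monoˡ-≤-nonNeg (ι 2) (Y₀≤32 M)) ⟩
    ι 128                  ∎
    where open ℚₚ.≤-Reasoning
  Y-decay (suc k) M = begin
    ι (3 ℕ.+ k) * Y (2 ℕ.+ k) M
      ≤⟨ ℚₚ.*-monoˡ-≤-nonNeg (ι (3 ℕ.+ k)) {{nonNegative (0≤ι (3 ℕ.+ k))}} (Y-ratio (suc k) M) ⟩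
    ι (3 ℕ.+ k) * (ι 2 * cube t * Y₁)
      ≡⟨ cong (_* (ι 2 * cube t * Y₁)) (ι-+ 3 k) ⟩
    (ι 3 + ι k) * (ι 2 * cube t * Y₁)
      -- The added term is the slack 3(k + 2) - 2(k + 3) = k.
      ≤⟨ p≤p+q (*-nonNeg (0≤ι k) (*-nonNeg (0≤cube 0≤t) (0≤Y (suc k) M))) ⟩
    (ι 3 + ι k) * (ι 2 * cube t * Y₁) + ι k * (cube t * Y₁)
      ≡⟨ solve 3 (λ k T Y → (c 3 :+ k) :* (c 2 :* T :* Y) :+ k :* (T :* Y)
                            := c 3 :* T :* ((c 2 :+ k) :* Y)) refl (ι k) (cube t) Y₁ ⟩
    ι 3 * cube t * ((ι 2 + ι k) * Y₁)
      ≡⟨ cong (λ s → ι 3 * cube t * (s * Y₁)) (ι-+ 2 k) ⟨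
    ι 3 * cube t * (t * Y₁)
      ≤⟨ ℚₚ.*-monoˡ-≤-nonNeg (ι 3 * cube t) {{nonNegative (*-nonNeg (0≤ι 3) (0≤cube 0≤t))}} (Y-decay k M) ⟩
    ι 3 * cube t * (ι 64 * p k)
      ≡⟨ solve 2 (λ T p → c 3 :* T :* (c 64 :* p) := c 64 :* (c 3 :* T :* p)) refl (cube t) (p k) ⟩
    ι 64 * (ι 3 * cube t * p k)
      ≤⟨ ℚₚ.*-monoˡ-≤-nonNeg (ι 64) (proj₂ (p-grows k)) ⟩
    ι 64 * p (suc k) ∎
    where
    open ℚₚ.≤-Reasoning
    t Y₁ : ℚ
    t = ι (2 ℕ.+ k)
    Y₁ = Y (suc k) M
    0≤t : 0ℚ ≤ t
    0≤t = 0≤ι (2 ℕ.+ k)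

-- From the linear form to convergence.

module Limit where
  open import Data.Nat as ℕ using (ℕ; suc)
  import Data.Nat.Properties as ℕₚ
  open import Data.Product using (_,_)
  open import Data.Rational
  import Data.Rational.Properties as ℚₚ
  open import Data.Rational.Solver using (module +-*-Solver)
  open import Relation.Binary.PropositionalEquality
  open +-*-Solver
  open RationalLemmas
  open CauchyLemmas using (recip; recip-inverse; split)
  open Naturals
  open Estimates
  open Telescoping
  open DombSeries
  open SeriesBounds
  open OddZeta
  open Convergents

  q≢0 : ∀ k → q k ≢ 0ℚ
  q≢0 k eq = ℚₚ.<-irrefl refl (ℚₚ.<-≤-trans (0<p k) (subst (λ t → p k ≤ ι 2 * t) eq (p≤2q k)))

  ÷-* : ∀ r s .{{_ : NonZero s}} → (r ÷ s) * s ≡ r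
  ÷-* r s = trans (ℚₚ.*-assoc r (1/ s) s) (trans (cong (r *_) (ℚₚ.*-inverseˡ s)) (ℚₚ.*-identityʳ r))

  -- Multiplication by 2Q · 7s clears both denominators and leaves the linear form; this multiplier
  -- is at least P. Here s stands for a partial sum of ζ(3).
  quotient-error : ∀ r P Q s → 0ℚ < P → P ≤ ι 2 * Q → 1ℚ ≤ s → r * Q ≡ P →
    ∣ r - ι 12 * recip (ι 7 * s) ∣ * P ≤ ∣ ι 14 * s * P - ι 24 * Q ∣
  quotient-error r P Q s 0<P P≤2Q 1≤s rQ≡P = begin
    D * P
      ≤⟨ ℚₚ.*-monoˡ-≤-nonNeg D {{ℚₚ.∣-∣-nonNeg d}} P≤2Qz ⟩
    D * (ι 2 * Q * z)
      ≡⟨ cong (D *_) (ℚₚ.0≤p⇒∣p∣≡p 0≤2Qz) ⟨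
    D * ∣ ι 2 * Q * z ∣
      ≡⟨ ℚₚ.∣p*q∣≡∣p∣*∣q∣ d (ι 2 * Q * z) ⟨
    ∣ d * (ι 2 * Q * z) ∣
      ≡⟨ cong ∣_∣ (solve 4 (λ r Q z w → (r :- c 12 :* w) :* (c 2 :* Q :* z)
                     := c 2 :* z :* (r :* Q) :- c 24 :* Q :* (z :* w)) refl r Q z w) ⟩
    ∣ ι 2 * z * (r * Q) - ι 24 * Q * (z * w) ∣
      ≡⟨ cong₂ (λ u v → ∣ ι 2 * z * u - ι 24 * Q * v ∣) rQ≡P (recip-inverse z z≢0) ⟩
    ∣ ι 2 * z * P - ι 24 * Q * 1ℚ ∣
      ≡⟨ cong ∣_∣ (solve 3 (λ s P Q → c 2 :* (c 7 :* s) :* P :- c 24 :* Q :* c 1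
                                       := c 14 :* s :* P :- c 24 :* Q) refl s P Q) ⟩
    ∣ ι 14 * s * P - ι 24 * Q ∣ ∎
    where
    open ℚₚ.≤-Reasoning
    z w d D : ℚ
    z = ι 7 * s
    w = recip z
    d = r - ι 12 * w
    D = ∣ d ∣
    1≤z : 1ℚ ≤ z
    1≤z = ℚₚ.≤-trans (ι-mono {1} {7} (ℕ.s≤s ℕ.z≤n)) (ℚₚ.*-monoˡ-≤-nonNeg (ι 7) 1≤s)
    z≢0 : z ≢ 0ℚ
    z≢0 z≡0 = ℚₚ.<-irrefl refl (ℚₚ.<-≤-trans (ℚₚ.positive⁻¹ 1ℚ) (subst (1ℚ ≤_) z≡0 1≤z))
    0≤2Q : 0ℚ ≤ ι 2 * Q
    0≤2Q = ℚₚ.≤-trans (ℚₚ.<⇒≤ 0<P) P≤2Q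
    P≤2Qz : P ≤ ι 2 * Q * z
    P≤2Qz = subst (_≤ ι 2 * Q * z) (ℚₚ.*-identityʳ P) (*-mono-≤ (ℚₚ.nonNegative⁻¹ 1ℚ) 0≤2Q P≤2Q 1≤z)
    0≤2Qz : 0ℚ ≤ ι 2 * Q * z
    0≤2Qz = ℚₚ.≤-trans (ℚₚ.<⇒≤ 0<P) P≤2Qz

  error-form : ℕ → ℕ → ℚ
  error-form k M = ι 14 * S M * p k - ι 24 * q k - Y (suc k) M

  error-form-O : ∀ k → O[1/n] (error-form k)
  error-form-O k = O-cong
    (λ M → solve 5 (λ Y₁ Y₀ S p q →
      (:- (Y₁ :- Y₀ :* p :+ c 24 :* q)) :+ (:- p) :* (Y₀ :- c 14 :* S)
      := c 14 :* S :* p :- c 24 :* q :- Y₁) refl (Y (suc k) M) (Y 0 M) (S M) (p k) (q k))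
    (O-+ (O-neg (Y-form-O k)) (O-scale (- p k) Y₀-14S-O))

  Y≤ : ∀ k M η → ι 64 * inv (suc k) ≤ η → Y (suc k) M ≤ η * p k
  Y≤ k M η 64/k≤η = begin
    Y₁                              ≡⟨ ℚₚ.*-identityˡ Y₁ ⟨
    1ℚ * Y₁                         ≡⟨ cong (_* Y₁) (ι*inv (suc k)) ⟨
    ι (2 ℕ.+ k) * i * Y₁            ≡⟨ solve 3 (λ t i y → t :* i :* y := i :* (t :* y)) refl (ι (2 ℕ.+ k)) i Y₁ ⟩
    i * (ι (2 ℕ.+ k) * Y₁)          ≤⟨ ℚₚ.*-monoˡ-≤-nonNeg i {{nonNegative (0≤inv (suc k))}} (Y-decay k M) ⟩
    i * (ι 64 * p k)                ≡⟨ solve 2 (λ i p → i :* (c 64 :* p) := c 64 :* i :* p) refl i (p k) ⟩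
    ι 64 * i * p k                  ≤⟨ ℚₚ.*-monoʳ-≤-nonNeg (p k) {{nonNegative (ℚₚ.<⇒≤ (0<p k))}} 64/k≤η ⟩
    η * p k                         ∎
    where
    open ℚₚ.≤-Reasoning
    i Y₁ : ℚ
    i = inv (suc k)
    Y₁ = Y (suc k) M

  converges : PCF-ConvergesTo a b (divide (fromℚ (ι 12)) 7ζ3 7ζ3#0)
  converges ε 0<ε =
    -- Of the four parts η, one bounds the truncation error, one the series, and two form the gap
    -- that the strict inequality `_<ᴿ_` demands.
    let η , 0<η , 4η≡ε = split (ι 4) ε (ℚₚ.positive⁻¹ (ι 4)) 0<ε
        μ , 0<μ , 64μ≡η = split (ι 64) η (ℚₚ.positive⁻¹ (ι 64)) 0<η
        N , 1/N≤μ = 1/n≤ μ 0<μ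
    in  N , λ k N≤k → q≢0 k ,
        let 64/k≤η : ι 64 * inv (suc k) ≤ η
            64/k≤η = subst (ι 64 * inv (suc k) ≤_) 64μ≡η (ℚₚ.*-monoˡ-≤-nonNeg (ι 64)
                       (ℚₚ.≤-trans (inv-anti (ℕₚ.m≤n⇒m≤1+n N≤k)) 1/N≤μ))
            M₀ , small = O⇒eventually (error-form-O k) (η * p k) (*-pos 0<η (0<p k))
        -- `M₀` depends on k. The 1 excludes the empty partial sum, whose value 0 cannot be
        -- inverted.
        in  ι 2 * η , *-pos (ℚₚ.positive⁻¹ (ι 2)) 0<η , 1 ℕ.⊔ M₀ , λ M M₀≤M →
            within η ε 4η≡ε k M 64/k≤η (ℕₚ.m⊔n≤o⇒m≤o 1 M₀ M₀≤M) (small M (ℕₚ.m⊔n≤o⇒n≤o 1 M₀ M₀≤M))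
    where
    within : ∀ η ε → ι 4 * η ≡ ε → ∀ k M → ι 64 * inv (suc k) ≤ η → 1 ℕ.≤ M → ∣ error-form k M ∣ ≤ η * p k →
             ∣ convergent a b k (q≢0 k) - ι 12 * recip (ι 7 * S M) ∣ + ι 2 * η ≤ ε
    within η ε 4η≡ε k M 64/k≤η 1≤M small = begin
      D + ι 2 * η            ≤⟨ ℚₚ.+-monoˡ-≤ (ι 2 * η)
                                  (ℚₚ.*-cancelʳ-≤-pos {D} {ι 2 * η} (p k) {{positive (0<p k)}} D*p≤) ⟩
      ι 2 * η + ι 2 * η      ≡⟨ solve 1 (λ η → c 2 :* η :+ c 2 :* η := c 4 :* η) refl η ⟩
      ι 4 * η                ≡⟨ 4η≡ε ⟩
      ε                      ∎
      where
      open ℚₚ.≤-Reasoning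
      r D Y₁ : ℚ
      r = convergent a b k (q≢0 k)
      D = ∣ r - ι 12 * recip (ι 7 * S M) ∣
      Y₁ = Y (suc k) M
      D*p≤ : D * p k ≤ ι 2 * η * p k
      D*p≤ = begin
        D * p k
          ≤⟨ quotient-error r (p k) (q k) (S M) (0<p k) (p≤2q k) (1≤S 1≤M)
               (÷-* (p k) (q k) {{≢-nonZero (q≢0 k)}}) ⟩
        ∣ ι 14 * S M * p k - ι 24 * q k ∣
          ≡⟨ cong ∣_∣ (solve 2 (λ f y → f := f :- y :+ y) refl (ι 14 * S M * p k - ι 24 * q k) Y₁) ⟩
        ∣ error-form k M + Y₁ ∣
          ≤⟨ ℚₚ.∣p+q∣≤∣p∣+∣q∣ (error-form k M) Y₁ ⟩
        ∣ error-form k M ∣ + ∣ Y₁ ∣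
          ≤⟨ ℚₚ.+-mono-≤ small (∣nonNeg∣ (0≤Y (suc k) M) (Y≤ k M η 64/k≤η)) ⟩
        η * p k + η * p k
          ≡⟨ solve 2 (λ η p → η :* p :+ η :* p := c 2 :* η :* p) refl η (p k) ⟩
        ι 2 * η * p k ∎

open import Data.Nat using (_+_; _*_; _^_)
open import Data.Integer using (+_)
open import Data.Rational using (_/_; -_)

theorem1p3 :
    PCF-ConvergesTo
      (λ n → + ((2 * n + 1) * (5 * n ^ 2 + 5 * n + 2)) / 1)
      (λ n → - (+ (16 * n ^ 6) / 1))
      (divide (fromℚ (+ 12 / 1)) 7ζ3 7ζ3#0)
theorem1p3 = Limit.converges
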